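{- Let $\mathbb X=\langle X,+_p,\oplus\rangle$ be a cancellative convex semilattice. Then there exists a Riesz space $V$ and a convex subset $Y$ of $V$ that is closed under binary suprema (taken in $V$), such that $\mathbb X$ is isomorphic to the convex semilattice induced by $V$ on $Y$.
   Context: A convex algebra is a set $X$ together with binary operations $+_p$, $p\in(0,1)$, satisfying for all $x,y,z\in X$ and $p,q\in(0,1)$: (idempotence) $x+_px=x$; (parametric commutativity) $x+_py=y+_{1-p}x$; (parametric associativity) $(x+_py)+_qz=x+_{pq}\big(y+_{\frac{(1-p)q}{1-pq}}z\big)$. It is cancellative if for all $x,y,z\in X$ and $p\in(0,1)$: $x+_pz=y+_pz$ implies $x=y$. A semilattice is a set with a binary operation $\oplus$ that is idempotent, commutative and associative. A convex semilattice $\langle X,+_p,\oplus\rangle$ is a set $X$ with binary operations $+_p$, $p\in(0,1)$, and $\oplus$ such that $\langle X,+_p\rangle$ is a convex algebra, $\langle X,\oplus\rangle$ is a semilattice, and for all $x,y,z\in X$, $p\in(0,1)$: $(x\oplus y)+_pz=(x+_pz)\oplus(y+_pz)$. A convex semilattice is called cancellative if its underlying convex algebra $\langle X,+_p\rangle$ is cancellative. An isomorphism of convex semilattices is a bijection preserving all operations $+_p$, $p\in(0,1)$, and $\oplus$. An ordered vector space is a vector space $V$ over $\mathbb R$ together with a partial order $\leq$ such that for all $x,y,z\in V$, $x\leq y$ implies $x+z\leq y+z$, and for all $x\in V$, $q>0$, $0\leq x$ implies $0\leq q\cdot x$. A Riesz space is an ordered vector space in which each two elements have a supremum and an infimum.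 A subset $Y$ of a real vector space is convex if $p\cdot x+(1-p)\cdot y\in Y$ for all $x,y\in Y$, $p\in(0,1)$. If $V$ is a Riesz space and $Y\subseteq V$ is convex and closed under binary suprema, the convex semilattice induced by $V$ on $Y$ is $\langle Y,+_p,\oplus\rangle$ with $x+_py:=p\cdot x+(1-p)\cdot y$ and $x\oplus y:=\sup\{x,y\}$ (supremum in $V$) for $x,y\in Y$, $p\in(0,1)$. -}

module Defs where

open import Level using (Level; _⊔_; suc)
open import Algebra.Apartness.Bundles using (HeytingField)
open import Algebra.Bundles using (CommutativeRing)
open import Algebra.Core using (Op₂)
open import Algebra.Lattice.Structures using (IsSemilattice)
open import Algebra.Module.Bundles using (LeftModule)
import Algebra.Definitions.RawMonoid as RawMonoidDefs
import Algebra.Properties.Ring as RingProperties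
open import Data.Empty using (⊥-elim)
open import Data.Nat.Base as ℕ using (ℕ)
open import Data.Product using (Σ; ∃-syntax; _×_; _,_; proj₁; proj₂)
open import Data.Sum.Base using (_⊎_; inj₁; inj₂)
open import Function.Definitions using (Congruent; Bijective)
open import Relation.Binary.Core using (Rel)
open import Relation.Binary.Lattice.Structures using (IsLattice)
open import Relation.Binary.Structures using (IsEquivalence; IsStrictPartialOrder)
open import Relation.Unary using (Pred)
import Relation.Binary.Reasoning.Setoid as SetoidReasoning

-- The field of real numbers, given by its characterisation (unique up to
-- isomorphism) as a Cauchy complete Archimedean ordered field.  The axioms are
-- the usual constructive ones; with excluded middle, apartness and tightness
-- make _<_ a strict total order and this is the classical notion.
record RealNumbers c ℓ₁ ℓ₂ : Set (suc (c ⊔ ℓ₁ ⊔ ℓ₂)) where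
  infix 4 _<_
  field
    heytingField : HeytingField c ℓ₁ ℓ₂

  open HeytingField heytingField public

  commutativeRing : CommutativeRing c ℓ₁
  commutativeRing = record { isCommutativeRing = isCommutativeRing }

  open CommutativeRing commutativeRing public using (ring; +-rawMonoid)
  open RawMonoidDefs +-rawMonoid using () renaming (_×_ to _·_)

  field
    _<_                  : Rel Carrier ℓ₂
    isStrictPartialOrder : IsStrictPartialOrder _≈_ _<_
    <⇒#                  : ∀ {x y} → x < y → x # y
    #⇒<⊎>                : ∀ {x y} → x # y → x < y ⊎ y < x
    +-monoˡ-<            : ∀ {x y} z → x < y → x + z < y + z
    *-pos                : ∀ {x y} → 0# < x → 0# < y → 0# < x * y
    archimedean          : ∀ x → ∃[ n ] x < n · 1#

  IsCauchy : (ℕ → Carrier) → Set (c ⊔ ℓ₂)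
  IsCauchy s = ∀ ε → 0# < ε → ∃[ N ] ∀ m n → N ℕ.≤ m → N ℕ.≤ n → s m < s n + ε

  ConvergesTo : (ℕ → Carrier) → Carrier → Set (c ⊔ ℓ₂)
  ConvergesTo s l =
    ∀ ε → 0# < ε → ∃[ N ] ∀ n → N ℕ.≤ n → s n < l + ε × l < s n + ε

  field
    complete : ∀ s → IsCauchy s → ∃[ l ] ConvergesTo s l

module OpenUnitInterval {c ℓ₁ ℓ₂ : Level} (ℝ : RealNumbers c ℓ₁ ℓ₂) where
  open RealNumbers ℝ
  open IsStrictPartialOrder isStrictPartialOrder public
    using (<-respʳ-≈; <-respˡ-≈)
    renaming (trans to <-trans; irrefl to <-irrefl)
  open RingProperties ring
  private module ≈R = SetoidReasoning setoid

  infix 4 _≈ᴵ_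
  infixl 7 _·ᴵ_

  record 𝕀 : Set (c ⊔ ℓ₂) where
    constructor mk𝕀
    field
      value : Carrier
      0<    : 0# < value
      <1    : value < 1#

  open 𝕀 public

  _≈ᴵ_ : Rel 𝕀 ℓ₁
  p ≈ᴵ q = value p ≈ value q

  x+[y-x]≈y : ∀ x y → x + (y - x) ≈ y
  x+[y-x]≈y x y = begin
    x + (y - x)    ≈⟨ +-comm x (y - x) ⟩
    y - x + x      ≈⟨ +-assoc y (- x) x ⟩
    y + (- x + x)  ≈⟨ +-congˡ (-‿inverseˡ x) ⟩
    y + 0#         ≈⟨ +-identityʳ y ⟩
    y              ∎
    where open ≈R

  x<y⇒0<y-x : ∀ {x y} → x < y → 0# < y - x
  x<y⇒0<y-x {x} x<y = <-respˡ-≈ (-‿inverseʳ x) (+-monoˡ-< (- x) x<y)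

  0<y-x⇒x<y : ∀ {x y} → 0# < y - x → x < y
  0<y-x⇒x<y {x} {y} h =
    <-respˡ-≈ (+-identityˡ x)
      (<-respʳ-≈ (trans (+-comm (y - x) x) (x+[y-x]≈y x y)) (+-monoˡ-< x h))

  [1-p]q≈q-pq : ∀ p q → (1# - p) * q ≈ q - p * q
  [1-p]q≈q-pq p q = begin
    (1# - p) * q          ≈⟨ distribʳ q 1# (- p) ⟩
    1# * q + (- p) * q    ≈⟨ +-cong (*-identityˡ q) (sym (-‿distribˡ-* p q)) ⟩
    q - p * q             ∎
    where open ≈R

  *-monoˡ-<-pos : ∀ {x y z} → 0# < z → x < y → x * z < y * z
  *-monoˡ-<-pos {x} {y} {z} 0<z x<y = 0<y-x⇒x<y (<-respʳ-≈ eq (*-pos (x<y⇒0<y-x x<y) 0<z))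
    where
    eq : (y - x) * z ≈ y * z - x * z
    eq = trans (distribʳ z y (- x)) (+-congˡ (sym (-‿distribˡ-* x z)))

  inverse-pos : ∀ {x y} → 0# < 1# → 0# < x → x * y ≈ 1# → 0# < y
  inverse-pos {x} {y} 0<1 0<x xy≈1 = case (#⇒<⊎> (invertible⇒# (x , left , right)))
    where
    y-0≈y : y - 0# ≈ y
    y-0≈y = trans (+-congˡ -0#≈0#) (+-identityʳ y)

    left : x * (y - 0#) ≈ 1#
    left = trans (*-congˡ y-0≈y) xy≈1

    right : (y - 0#) * x ≈ 1#
    right = trans (*-comm _ x) left

    case : y < 0# ⊎ 0# < y → 0# < y
    case (inj₂ 0<y) = 0<y
    case (inj₁ y<0) = ⊥-elim (<-irrefl refl (<-trans 0<1 1<0))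
      where
      1<0 : 1# < 0#
      1<0 = <-respˡ-≈ (trans (*-comm y x) xy≈1) (<-respʳ-≈ (zeroˡ x) (*-monoˡ-<-pos 0<x y<0))

  p*q<q : ∀ (p q : 𝕀) → value p * value q < value q
  p*q<q p q = <-respʳ-≈ (*-identityˡ (value q)) (*-monoˡ-<-pos (0< q) (<1 p))

  1-[1-x]≈x : ∀ x → 1# - (1# - x) ≈ x
  1-[1-x]≈x x = begin
    1# - (1# - x)      ≈⟨ +-congˡ (-‿+-comm 1# (- x)) ⟨
    1# + (- 1# - - x)  ≈⟨ +-assoc 1# (- 1#) _ ⟨
    1# - 1# - - x      ≈⟨ +-cong (-‿inverseʳ 1#) (-‿involutive x) ⟩
    0# + x             ≈⟨ +-identityˡ x ⟩
    x                  ∎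
    where open ≈R

  1-ᴵ_ : 𝕀 → 𝕀
  1-ᴵ p = mk𝕀 (1# - value p) (x<y⇒0<y-x (<1 p))
    (0<y-x⇒x<y (<-respʳ-≈ (sym (1-[1-x]≈x (value p))) (0< p)))

  _·ᴵ_ : 𝕀 → 𝕀 → 𝕀
  p ·ᴵ q = mk𝕀 (value p * value q) (*-pos (0< p) (0< q)) (<-trans (p*q<q p q) (<1 q))

  [1-_]⁻¹ : 𝕀 → Carrier
  [1- p ]⁻¹ = proj₁ (#⇒invertible (#-sym (<⇒# (<1 p))))

  *-[1-_]⁻¹ : ∀ p → (1# - value p) * [1- p ]⁻¹ ≈ 1#
  *-[1- p ]⁻¹ = proj₂ (proj₂ (#⇒invertible (#-sym (<⇒# (<1 p)))))

  -- (1 - p) q / (1 - p q)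
  assocWeight : 𝕀 → 𝕀 → 𝕀
  assocWeight p q = mk𝕀 ((1# - value p) * value q * i)
    (*-pos (*-pos (0< (1-ᴵ p)) (0< q)) 0<i)
    (<-respʳ-≈ (*-[1- p ·ᴵ q ]⁻¹) (*-monoˡ-<-pos 0<i num<den))
    where
    i : Carrier
    i = [1- p ·ᴵ q ]⁻¹

    0<i : 0# < i
    0<i = inverse-pos (<-trans (0< p) (<1 p)) (0< (1-ᴵ (p ·ᴵ q))) (*-[1- p ·ᴵ q ]⁻¹)

    num<den : (1# - value p) * value q < 1# - value p * value q
    num<den = <-respˡ-≈ (sym ([1-p]q≈q-pq (value p) (value q))) (+-monoˡ-< _ (<1 q))

  assocWeight-left : ∀ p q →
    (1# - value (p ·ᴵ q)) * value (assocWeight p q) ≈ (1# - value p) * value q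
  assocWeight-left p q = begin
    d * (n * i)  ≈⟨ *-congˡ (*-comm n i) ⟩
    d * (i * n)  ≈⟨ *-assoc d i n ⟨
    d * i * n    ≈⟨ *-congʳ (*-[1- p ·ᴵ q ]⁻¹) ⟩
    1# * n       ≈⟨ *-identityˡ n ⟩
    n            ∎
    where
    open ≈R
    d n i : Carrier
    d = 1# - value (p ·ᴵ q)
    n = (1# - value p) * value q
    i = [1- p ·ᴵ q ]⁻¹

  assocWeight-right : ∀ p q →
    (1# - value (p ·ᴵ q)) * (1# - value (assocWeight p q)) ≈ 1# - value q
  assocWeight-right p q = begin
    d * (1# - r)                         ≈⟨ distribˡ d 1# (- r) ⟩
    d * 1# + d * - r                     ≈⟨ +-cong (*-identityʳ d) (sym (-‿distribʳ-* d r)) ⟩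
    d - d * r                            ≈⟨ +-congˡ (-‿cong (assocWeight-left p q)) ⟩
    d - (1# - value p) * value q         ≈⟨ +-congˡ (-‿cong ([1-p]q≈q-pq (value p) (value q))) ⟩
    1# - pq - (value q - pq)             ≈⟨ +-congˡ (-‿+-comm (value q) (- pq)) ⟨
    1# - pq + (- value q - - pq)         ≈⟨ +-congˡ (+-comm (- value q) (- - pq)) ⟩
    1# - pq + (- - pq - value q)         ≈⟨ +-assoc _ (- - pq) (- value q) ⟨
    1# - pq - - pq - value q             ≈⟨ +-congʳ (+-assoc 1# (- pq) (- - pq)) ⟩
    1# + (- pq - - pq) - value q         ≈⟨ +-congʳ (+-congˡ (-‿inverseʳ (- pq))) ⟩
    1# + 0# - value q                    ≈⟨ +-congʳ (+-identityʳ 1#) ⟩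
    1# - value q                         ∎
    where
    open ≈R
    d r pq : Carrier
    d  = 1# - value (p ·ᴵ q)
    r  = value (assocWeight p q)
    pq = value p * value q

module _ {c ℓ₁ ℓ₂ : Level} (ℝ : RealNumbers c ℓ₁ ℓ₂) where
  private module ℝ = RealNumbers ℝ
  open OpenUnitInterval ℝ

  record IsConvexAlgebra {a ℓ} {X : Set a} (_≈_ : Rel X ℓ) (_+⟨_⟩_ : X → 𝕀 → X → X)
    : Set (c ⊔ ℓ₁ ⊔ ℓ₂ ⊔ a ⊔ ℓ) where
    field
      isEquivalence : IsEquivalence _≈_
      +-cong  : ∀ {x x′ p p′ y y′} → x ≈ x′ → p ≈ᴵ p′ → y ≈ y′ →
                (x +⟨ p ⟩ y) ≈ (x′ +⟨ p′ ⟩ y′)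
      +-idem  : ∀ x p → (x +⟨ p ⟩ x) ≈ x
      +-comm  : ∀ x y p → (x +⟨ p ⟩ y) ≈ (y +⟨ 1-ᴵ p ⟩ x)
      +-assoc : ∀ x y z p q →
                ((x +⟨ p ⟩ y) +⟨ q ⟩ z) ≈ (x +⟨ p ·ᴵ q ⟩ (y +⟨ assocWeight p q ⟩ z))

  record ConvexSemilattice a ℓ : Set (c ⊔ ℓ₁ ⊔ ℓ₂ ⊔ suc (a ⊔ ℓ)) where
    infix  4 _≈_
    infixl 6 _+⟨_⟩_
    infixr 6 _⊕_
    field
      Carrier         : Set a
      _≈_             : Rel Carrier ℓ
      _+⟨_⟩_          : Carrier → 𝕀 → Carrier → Carrier
      _⊕_             : Op₂ Carrier
      isConvexAlgebra : IsConvexAlgebra _≈_ _+⟨_⟩_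
      isSemilattice   : IsSemilattice _≈_ _⊕_
      +-distribʳ-⊕    : ∀ x y z p →
                        ((x ⊕ y) +⟨ p ⟩ z) ≈ ((x +⟨ p ⟩ z) ⊕ (y +⟨ p ⟩ z))

    open IsConvexAlgebra isConvexAlgebra public

  Cancellative : ∀ {a ℓ} → ConvexSemilattice a ℓ → Set (c ⊔ ℓ₂ ⊔ a ⊔ ℓ)
  Cancellative 𝕏 = ∀ x y z p → x +⟨ p ⟩ z ≈ y +⟨ p ⟩ z → x ≈ y
    where open ConvexSemilattice 𝕏

  record RieszSpace m ℓm ℓ≤ : Set (c ⊔ ℓ₁ ⊔ ℓ₂ ⊔ suc (m ⊔ ℓm ⊔ ℓ≤)) where
    infix  4 _≤_
    infixr 6 _∨_
    infixr 7 _∧_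
    field
      vectorSpace : LeftModule ℝ.ring m ℓm

    open LeftModule vectorSpace public

    field
      _≤_       : Rel Carrierᴹ ℓ≤
      _∨_       : Op₂ Carrierᴹ
      _∧_       : Op₂ Carrierᴹ
      isLattice : IsLattice _≈ᴹ_ _≤_ _∨_ _∧_
      +ᴹ-monoˡ  : ∀ {x y} z → x ≤ y → x +ᴹ z ≤ y +ᴹ z
      *ₗ-pos    : ∀ {x q} → ℝ.0# ℝ.< q → 0ᴹ ≤ x → 0ᴹ ≤ q *ₗ x

    open IsLattice isLattice public
      hiding (module Eq)
      renaming (refl to ≤-refl; reflexive to ≤-reflexive; trans to ≤-trans; antisym to ≤-antisym)

    infixl 6 _+⟨_⟩ᴹ_

    _+⟨_⟩ᴹ_ : Carrierᴹ → 𝕀 → Carrierᴹ → Carrierᴹ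
    x +⟨ p ⟩ᴹ y = value p *ₗ x +ᴹ (ℝ.1# ℝ.- value p) *ₗ y

  record ConvexSupClosedSubset {m ℓm ℓ≤} (V : RieszSpace m ℓm ℓ≤) ℓ
    : Set (c ⊔ ℓ₂ ⊔ m ⊔ ℓm ⊔ suc ℓ) where
    open RieszSpace V
    field
      Member   : Pred Carrierᴹ ℓ
      respects : ∀ {x y} → x ≈ᴹ y → Member x → Member y
      convex   : ∀ {x y} p → Member x → Member y → Member (x +⟨ p ⟩ᴹ y)
      ∨-closed : ∀ {x y} → Member x → Member y → Member (x ∨ y)

  module RieszLemmas {m ℓm ℓ≤ : Level} (V : RieszSpace m ℓm ℓ≤) where
    open RieszSpace V
    open ℝ using (Carrier; 1#; 0#; _-_; -_)
    private module ≈R = SetoidReasoning ≈ᴹ-setoid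

    +-interchange : ∀ a b d e → (a +ᴹ b) +ᴹ (d +ᴹ e) ≈ᴹ (a +ᴹ d) +ᴹ (b +ᴹ e)
    +-interchange a b d e = begin
      (a +ᴹ b) +ᴹ (d +ᴹ e)  ≈⟨ +ᴹ-assoc a b _ ⟩
      a +ᴹ (b +ᴹ (d +ᴹ e))  ≈⟨ +ᴹ-congˡ (+ᴹ-assoc b d e) ⟨
      a +ᴹ ((b +ᴹ d) +ᴹ e)  ≈⟨ +ᴹ-congˡ (+ᴹ-congʳ (+ᴹ-comm b d)) ⟩
      a +ᴹ ((d +ᴹ b) +ᴹ e)  ≈⟨ +ᴹ-congˡ (+ᴹ-assoc d b e) ⟩
      a +ᴹ (d +ᴹ (b +ᴹ e))  ≈⟨ +ᴹ-assoc a d _ ⟨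
      (a +ᴹ d) +ᴹ (b +ᴹ e)  ∎
      where open ≈R

    -‿cancelʳ : ∀ x z → (x +ᴹ z) +ᴹ (-ᴹ z) ≈ᴹ x
    -‿cancelʳ x z =
      ≈ᴹ-trans (+ᴹ-assoc x z _) (≈ᴹ-trans (+ᴹ-congˡ (-ᴹ‿inverseʳ z)) (+ᴹ-identityʳ x))

    -‿cancelʳ′ : ∀ x z → (x +ᴹ (-ᴹ z)) +ᴹ z ≈ᴹ x
    -‿cancelʳ′ x z =
      ≈ᴹ-trans (+ᴹ-assoc x _ z) (≈ᴹ-trans (+ᴹ-congˡ (-ᴹ‿inverseˡ z)) (+ᴹ-identityʳ x))

    ≤-resp : ∀ {x x′ y y′} → x ≈ᴹ x′ → y ≈ᴹ y′ → x ≤ y → x′ ≤ y′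
    ≤-resp x≈ y≈ x≤y = ≤-trans (≤-reflexive (≈ᴹ-sym x≈)) (≤-trans x≤y (≤-reflexive y≈))

    *ₗ-mono : ∀ {x y q} → 0# ℝ.< q → x ≤ y → q *ₗ x ≤ q *ₗ y
    *ₗ-mono {x} {y} {q} 0<q x≤y = ≤-resp (+ᴹ-identityˡ _) eq (+ᴹ-monoˡ (q *ₗ x) 0≤q[y-x])
      where
      0≤q[y-x] : 0ᴹ ≤ q *ₗ (y +ᴹ (-ᴹ x))
      0≤q[y-x] = *ₗ-pos 0<q (≤-resp (-ᴹ‿inverseʳ x) ≈ᴹ-refl (+ᴹ-monoˡ (-ᴹ x) x≤y))

      eq : q *ₗ (y +ᴹ (-ᴹ x)) +ᴹ q *ₗ x ≈ᴹ q *ₗ y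
      eq = ≈ᴹ-trans (≈ᴹ-sym (*ₗ-distribˡ q _ x)) (*ₗ-cong ℝ.refl (-‿cancelʳ′ y x))

    ∨-cong : ∀ {x x′ y y′} → x ≈ᴹ x′ → y ≈ᴹ y′ → x ∨ y ≈ᴹ x′ ∨ y′
    ∨-cong x≈ y≈ = ≤-antisym (half x≈ y≈) (half (≈ᴹ-sym x≈) (≈ᴹ-sym y≈))
      where
      half : ∀ {x x′ y y′} → x ≈ᴹ x′ → y ≈ᴹ y′ → x ∨ y ≤ x′ ∨ y′
      half {x} {x′} {y} {y′} x≈ y≈ = ∨-least
        (≤-trans (≤-reflexive x≈) (x≤x∨y x′ y′))
        (≤-trans (≤-reflexive y≈) (y≤x∨y x′ y′))

    ∨-isSemilattice : IsSemilattice _≈ᴹ_ _∨_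
    ∨-isSemilattice = record
      { isBand = record
        { isSemigroup = record
          { isMagma = record { isEquivalence = ≈ᴹ-isEquivalence ; ∙-cong = ∨-cong }
          ; assoc = λ x y z → ≤-antisym
              (∨-least
                (∨-least (x≤x∨y x _) (≤-trans (x≤x∨y y z) (y≤x∨y x _)))
                (≤-trans (y≤x∨y y z) (y≤x∨y x _)))
              (∨-least
                (≤-trans (x≤x∨y x y) (x≤x∨y _ z))
                (∨-least (≤-trans (y≤x∨y x y) (x≤x∨y _ z)) (y≤x∨y _ z)))
          }
        ; idem = λ x → ≤-antisym (∨-least ≤-refl ≤-refl) (x≤x∨y x x)
        }
      ; comm = λ x y → ≤-antisym
          (∨-least (y≤x∨y y x) (x≤x∨y y x)) (∨-least (y≤x∨y x y) (x≤x∨y x y))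
      }

    +ᴹ-distribʳ-∨ : ∀ x y z → (x ∨ y) +ᴹ z ≈ᴹ (x +ᴹ z) ∨ (y +ᴹ z)
    +ᴹ-distribʳ-∨ x y z = ≤-antisym
      (≤-resp ≈ᴹ-refl (-‿cancelʳ′ _ z)
        (+ᴹ-monoˡ z (∨-least
          (≤-resp (-‿cancelʳ x z) ≈ᴹ-refl (+ᴹ-monoˡ (-ᴹ z) (x≤x∨y (x +ᴹ z) (y +ᴹ z))))
          (≤-resp (-‿cancelʳ y z) ≈ᴹ-refl (+ᴹ-monoˡ (-ᴹ z) (y≤x∨y (x +ᴹ z) (y +ᴹ z)))))))
      (∨-least (+ᴹ-monoˡ z (x≤x∨y x y)) (+ᴹ-monoˡ z (y≤x∨y x y)))

    *ₗ-distribˡ-∨ : ∀ x y (p : 𝕀) → value p *ₗ (x ∨ y) ≈ᴹ (value p *ₗ x) ∨ (value p *ₗ y)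
    *ₗ-distribˡ-∨ x y p = ≤-antisym
      (≤-resp ≈ᴹ-refl (unscale pi≈1 _)
        (*ₗ-mono (0< p) (∨-least
          (≤-resp (unscale ip≈1 x) ≈ᴹ-refl (*ₗ-mono 0<i (x≤x∨y _ _)))
          (≤-resp (unscale ip≈1 y) ≈ᴹ-refl (*ₗ-mono 0<i (y≤x∨y _ _))))))
      (∨-least (*ₗ-mono (0< p) (x≤x∨y x y)) (*ₗ-mono (0< p) (y≤x∨y x y)))
      where
      i : Carrier
      i = [1- 1-ᴵ p ]⁻¹

      pi≈1 : value p ℝ.* i ℝ.≈ 1#
      pi≈1 = ℝ.trans (ℝ.*-congʳ (ℝ.sym (1-[1-x]≈x (value p)))) (*-[1- 1-ᴵ p ]⁻¹)

      ip≈1 : i ℝ.* value p ℝ.≈ 1#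
      ip≈1 = ℝ.trans (ℝ.*-comm i (value p)) pi≈1

      0<i : 0# ℝ.< i
      0<i = inverse-pos (<-trans (0< p) (<1 p)) (0< p) pi≈1

      unscale : ∀ {r s} → r ℝ.* s ℝ.≈ 1# → ∀ v → r *ₗ (s *ₗ v) ≈ᴹ v
      unscale {r} {s} rs≈1 v =
        ≈ᴹ-trans (≈ᴹ-sym (*ₗ-assoc r s v)) (≈ᴹ-trans (*ₗ-cong rs≈1 ≈ᴹ-refl) (*ₗ-identityˡ v))

    isConvexAlgebra : IsConvexAlgebra _≈ᴹ_ _+⟨_⟩ᴹ_
    isConvexAlgebra = record
      { isEquivalence = ≈ᴹ-isEquivalence
      ; +-cong = λ x≈ p≈ y≈ →
          +ᴹ-cong (*ₗ-cong p≈ x≈) (*ₗ-cong (ℝ.+-congˡ (ℝ.-‿cong p≈)) y≈)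
      ; +-idem = λ x p →
          ≈ᴹ-trans (≈ᴹ-sym (*ₗ-distribʳ x (value p) (1# - value p)))
            (≈ᴹ-trans (*ₗ-cong (x+[y-x]≈y (value p) 1#) ≈ᴹ-refl) (*ₗ-identityˡ x))
      ; +-comm = λ x y p →
          ≈ᴹ-trans (+ᴹ-comm _ _)
            (+ᴹ-congˡ (*ₗ-cong (ℝ.sym (1-[1-x]≈x (value p))) ≈ᴹ-refl))
      ; +-assoc = assoc
      }
      where
      assoc : ∀ x y z p q →
        ((x +⟨ p ⟩ᴹ y) +⟨ q ⟩ᴹ z) ≈ᴹ (x +⟨ p ·ᴵ q ⟩ᴹ (y +⟨ assocWeight p q ⟩ᴹ z))
      assoc x y z p q = begin
        q′ *ₗ (p′ *ₗ x +ᴹ p̄ *ₗ y) +ᴹ q̄ *ₗ z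
          ≈⟨ +ᴹ-congʳ (*ₗ-distribˡ q′ _ _) ⟩
        (q′ *ₗ (p′ *ₗ x) +ᴹ q′ *ₗ (p̄ *ₗ y)) +ᴹ q̄ *ₗ z
          ≈⟨ +ᴹ-assoc _ _ _ ⟩
        q′ *ₗ (p′ *ₗ x) +ᴹ (q′ *ₗ (p̄ *ₗ y) +ᴹ q̄ *ₗ z)
          ≈⟨ +ᴹ-cong (merge (ℝ.*-comm q′ p′) x)
               (+ᴹ-cong (merge (ℝ.*-comm q′ p̄) y) ≈ᴹ-refl) ⟩
        (p′ ℝ.* q′) *ₗ x +ᴹ ((p̄ ℝ.* q′) *ₗ y +ᴹ q̄ *ₗ z)
          ≈⟨ +ᴹ-congˡ (+ᴹ-cong (merge (assocWeight-left p q) y)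
               (merge (assocWeight-right p q) z)) ⟨
        (p′ ℝ.* q′) *ₗ x +ᴹ (d *ₗ (r *ₗ y) +ᴹ d *ₗ ((1# - r) *ₗ z))
          ≈⟨ +ᴹ-congˡ (*ₗ-distribˡ d _ _) ⟨
        (p′ ℝ.* q′) *ₗ x +ᴹ d *ₗ (r *ₗ y +ᴹ (1# - r) *ₗ z) ∎
        where
        open ≈R
        p′ q′ p̄ q̄ d r : Carrier
        p′ = value p
        q′ = value q
        p̄ = 1# - p′
        q̄ = 1# - q′
        d  = 1# - p′ ℝ.* q′
        r  = value (assocWeight p q)

        merge : ∀ {s t u} → s ℝ.* t ℝ.≈ u → ∀ v → s *ₗ (t *ₗ v) ≈ᴹ u *ₗ v
        merge st≈u v = ≈ᴹ-trans (≈ᴹ-sym (*ₗ-assoc _ _ v)) (*ₗ-cong st≈u ≈ᴹ-refl)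

    convex-distribʳ-∨ : ∀ x y z p → ((x ∨ y) +⟨ p ⟩ᴹ z) ≈ᴹ ((x +⟨ p ⟩ᴹ z) ∨ (y +⟨ p ⟩ᴹ z))
    convex-distribʳ-∨ x y z p =
      ≈ᴹ-trans (+ᴹ-congʳ (*ₗ-distribˡ-∨ x y p)) (+ᴹ-distribʳ-∨ _ _ _)

  induced : ∀ {m ℓm ℓ≤ ℓ} (V : RieszSpace m ℓm ℓ≤) →
            ConvexSupClosedSubset V ℓ → ConvexSemilattice (m ⊔ ℓ) ℓm
  induced V Y = record
    { Carrier = Σ Carrierᴹ Member
    ; _≈_     = λ x y → proj₁ x ≈ᴹ proj₁ y
    ; _+⟨_⟩_  = λ (x , x∈Y) p (y , y∈Y) → (x +⟨ p ⟩ᴹ y) , convex p x∈Y y∈Y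
    ; _⊕_     = λ (x , x∈Y) (y , y∈Y) → (x ∨ y) , ∨-closed x∈Y y∈Y
    ; isConvexAlgebra = record
      { isEquivalence = record { refl = ≈ᴹ-refl ; sym = ≈ᴹ-sym ; trans = ≈ᴹ-trans }
      ; +-cong  = λ {_} {_} {p} {p′} x≈ p≈ y≈ →
          IsConvexAlgebra.+-cong isConvexAlgebra {p = p} {p′ = p′} x≈ p≈ y≈
      ; +-idem  = λ (x , _) → IsConvexAlgebra.+-idem isConvexAlgebra x
      ; +-comm  = λ (x , _) (y , _) → IsConvexAlgebra.+-comm isConvexAlgebra x y
      ; +-assoc = λ (x , _) (y , _) (z , _) → IsConvexAlgebra.+-assoc isConvexAlgebra x y z
      }
    ; isSemilattice = record
      { isBand = record
        { isSemigroup = record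
          { isMagma = record
            { isEquivalence = record { refl = ≈ᴹ-refl ; sym = ≈ᴹ-sym ; trans = ≈ᴹ-trans }
            ; ∙-cong = ∨-cong
            }
          ; assoc = λ (x , _) (y , _) (z , _) → ∨-assoc x y z
          }
        ; idem = λ (x , _) → ∨-idem x
        }
      ; comm = λ (x , _) (y , _) → ∨-comm x y
      }
    ; +-distribʳ-⊕ = λ (x , _) (y , _) (z , _) → convex-distribʳ-∨ x y z
    }
    where
    open RieszSpace V
    open ConvexSupClosedSubset Y
    open RieszLemmas V
    open IsSemilattice _≈ᴹ_ ∨-isSemilattice using ()
      renaming (assoc to ∨-assoc; idem to ∨-idem; comm to ∨-comm)

  record Isomorphism {a₁ ℓa₁ a₂ ℓa₂} (𝕏 : ConvexSemilattice a₁ ℓa₁) (𝕐 : ConvexSemilattice a₂ ℓa₂)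
    : Set (c ⊔ ℓ₂ ⊔ a₁ ⊔ ℓa₁ ⊔ a₂ ⊔ ℓa₂) where
    private
      module X = ConvexSemilattice 𝕏
      module Y = ConvexSemilattice 𝕐
    field
      to        : X.Carrier → Y.Carrier
      cong      : Congruent X._≈_ Y._≈_ to
      bijective : Bijective X._≈_ Y._≈_ to
      +-homo    : ∀ x y p → to (x X.+⟨ p ⟩ y) Y.≈ to x Y.+⟨ p ⟩ to y
      ⊕-homo    : ∀ x y → to (x X.⊕ y) Y.≈ to x Y.⊕ to y

{-# OPTIONS --safe #-}
module Submission where

open import Defs
open import Level using (Level; _⊔_)
open import Algebra.Bundles using (AbelianGroup; CommutativeMonoid; CommutativeRing; CommutativeSemigroup)
open import Algebra.Lattice.Structures using (IsSemilattice)
open import Algebra.Module.Bundles using (LeftModule)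
import Algebra.Definitions.RawMonoid as RawMonoidDefs
import Algebra.Properties.AbelianGroup as AbelianGroupProperties
import Algebra.Properties.CommutativeSemigroup as CommutativeSemigroupProperties
import Algebra.Properties.Ring as RingProperties
import Algebra.Solver.Ring.NaturalCoefficients.Default as SemiringSolver
open import Data.Nat.Base using (ℕ)
open import Data.Product using (Σ-syntax; ∃-syntax; _,_; proj₁; proj₂)
open import Data.Sum.Base using (_⊎_; inj₁; inj₂)
open import Relation.Binary.Bundles using (Poset)
open import Relation.Binary.Core using (Rel)
open import Relation.Binary.Lattice.Structures using (IsLattice)
open import Relation.Binary.Structures using (IsEquivalence)
import Relation.Binary.Construct.Interior.Symmetric as Sym
import Relation.Binary.Reasoning.PartialOrder as PosetReasoning
import Relation.Binary.Reasoning.Setoid as SetoidReasoning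

-- The multiples t · x with t > 0 form a cancellative commutative semigroup, in
-- whose group of differences the elements t · (x - y) form a Riesz space W:
-- positivity of t · (x - y) means y ⊕ x = x, and t · (x ⊕ y - b) is the supremum
-- of t · (x - b) and t · (y - b).  After the choice of a base point b, x ↦ x - b
-- embeds X in W.  As X is not known to be inhabited, all base points are used at
-- once: x is sent to the family (x - b) indexed by b ∈ X, an element of the power
-- of W, and injectivity is seen in the coordinate b = x.

-- Positive reals and the weights s/(s + t).

module PositiveReals {c ℓ₁ ℓ₂ : Level} (ℝ : RealNumbers c ℓ₁ ℓ₂) where
  open RealNumbers ℝ
  open RawMonoidDefs +-rawMonoid using () renaming (_×_ to _·_)
  open OpenUnitInterval ℝ
  open RingProperties ring
  open CommutativeSemigroupProperties
    (CommutativeMonoid.commutativeSemigroup (CommutativeRing.*-commutativeMonoid commutativeRing))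
    using (x∙yz≈xz∙y)
  open SetoidReasoning setoid

  abstract
    -- Invertibility gives that `1#` is apart from `0#`. In the case `1# < 0#` the element `- 1#` is
    -- positive, and `1#` is its square.
    0<1 : 0# < 1#
    0<1 = case (#⇒<⊎> (invertible⇒# (1# , left , trans (*-comm _ _) left)))
      where
      left : 1# * (1# - 0#) ≈ 1#
      left = trans (*-identityˡ _) (trans (+-congˡ -0#≈0#) (+-identityʳ 1#))

      case : 1# < 0# ⊎ 0# < 1# → 0# < 1#
      case (inj₂ 0<1) = 0<1
      case (inj₁ 1<0) = <-respʳ-≈ [-1][-1]≈1 (*-pos 0<-1 0<-1)
        where
        0<-1 : 0# < - 1#
        0<-1 = <-respʳ-≈ (+-identityˡ _) (x<y⇒0<y-x 1<0)

        [-1][-1]≈1 : - 1# * - 1# ≈ 1#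
        [-1][-1]≈1 = trans (-1*x≈-x (- 1#)) (-‿involutive 1#)

    +-pos : ∀ {x y} → 0# < x → 0# < y → 0# < x + y
    +-pos {x} {y} 0<x 0<y = <-trans 0<y (<-respˡ-≈ (+-identityˡ y) (+-monoˡ-< y 0<x))

  record ℝ⁺ : Set (c ⊔ ℓ₂) where
    constructor mk⁺
    field
      val     : Carrier
      val-pos : 0# < val

  open ℝ⁺ public

  infix  4 _≈⁺_
  infixl 6 _+⁺_
  infixl 7 _*⁺_

  _≈⁺_ : Rel ℝ⁺ ℓ₁
  s ≈⁺ t = val s ≈ val t

  _+⁺_ _*⁺_ : ℝ⁺ → ℝ⁺ → ℝ⁺
  s +⁺ t = mk⁺ (val s + val t) (+-pos (val-pos s) (val-pos t))
  s *⁺ t = mk⁺ (val s * val t) (*-pos (val-pos s) (val-pos t))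

  1⁺ : ℝ⁺
  1⁺ = mk⁺ 1# 0<1

  fromUnit : 𝕀 → ℝ⁺
  fromUnit p = mk⁺ (value p) (0< p)

  recip : ∀ (t : ℝ⁺) → ∃[ i ] val t * i ≈ 1#
  recip t with i , _ , ti≈1 ← #⇒invertible (#-sym (<⇒# (val-pos t))) =
    -- The field axiom inverts the difference `val t - 0#`, from which the `0#` has to be removed.
    i , trans (*-congʳ (sym (trans (+-congˡ -0#≈0#) (+-identityʳ _)))) ti≈1

  *-cancelˡ-pos : ∀ (t : ℝ⁺) {x y} → val t * x ≈ val t * y → x ≈ y
  *-cancelˡ-pos t {x} {y} tx≈ty = begin
    x                ≈⟨ unscale x ⟨
    i * (val t * x)  ≈⟨ *-congˡ tx≈ty ⟩
    i * (val t * y)  ≈⟨ unscale y ⟩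
    y                ∎
    where
    i : Carrier
    i = proj₁ (recip t)

    unscale : ∀ z → i * (val t * z) ≈ z
    unscale z = begin
      i * (val t * z)  ≈⟨ *-assoc i (val t) z ⟨
      i * val t * z    ≈⟨ *-congʳ (trans (*-comm i (val t)) (proj₂ (recip t))) ⟩
      1# * z           ≈⟨ *-identityˡ z ⟩
      z                ∎

  abstract
    -- The weight s/(s + t), for which s x + t y is (s + t) times a convex combination of x and y.
    -- Being abstract, it is used below only through `frac-spec`.
    frac : ℝ⁺ → ℝ⁺ → 𝕀
    frac s t = mk𝕀 (val s * i) (*-pos (val-pos s) 0<i)
      (<-respʳ-≈ (proj₂ (recip (s +⁺ t))) (*-monoˡ-<-pos 0<i s<s+t))
      where
      i : Carrier
      i = proj₁ (recip (s +⁺ t))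

      0<i : 0# < i
      0<i = inverse-pos 0<1 (val-pos (s +⁺ t)) (proj₂ (recip (s +⁺ t)))

      s<s+t : val s < val s + val t
      s<s+t = <-respˡ-≈ (+-identityˡ _)
        (<-respʳ-≈ (+-comm (val t) (val s)) (+-monoˡ-< (val s) (val-pos t)))

    frac-spec : ∀ s t → (val s + val t) * value (frac s t) ≈ val s
    frac-spec s t = begin
      T * (val s * i)  ≈⟨ x∙yz≈xz∙y T (val s) i ⟩
      T * i * val s    ≈⟨ *-congʳ (proj₂ (recip (s +⁺ t))) ⟩
      1# * val s       ≈⟨ *-identityˡ _ ⟩
      val s            ∎
      where
      T i : Carrier
      T = val s + val t
      i = proj₁ (recip (s +⁺ t))

  -- The denominator s + t is positive and cancels. Identities between weights are proved by
  -- multiplying out and appealing to this lemma.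
  frac-unique : ∀ s t {v} → (val s + val t) * v ≈ val s → v ≈ value (frac s t)
  frac-unique s t Tv≈s = *-cancelˡ-pos (s +⁺ t) (trans Tv≈s (sym (frac-spec s t)))

  -- If `v` is the share x/T of a total x + y, then `1# - v` is the share y/T. This handles the
  -- complements that occur in parametric commutativity and associativity.
  complement : ∀ {T x y v} → T ≈ x + y → T * v ≈ x → T * (1# - v) ≈ y
  complement {T} {x} {y} {v} T≈x+y Tv≈x = begin
    T * (1# - v)      ≈⟨ distribˡ T 1# (- v) ⟩
    T * 1# + T * - v  ≈⟨ +-cong (trans (*-identityʳ T) T≈x+y) (sym (-‿distribʳ-* T v)) ⟩
    x + y - T * v     ≈⟨ +-cong (+-comm x y) (-‿cong Tv≈x) ⟩
    y + x - x         ≈⟨ +-assoc y x (- x) ⟩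
    y + (x - x)       ≈⟨ +-congˡ (-‿inverseʳ x) ⟩
    y + 0#            ≈⟨ +-identityʳ y ⟩
    y                 ∎

  frac-cong : ∀ {s s′ t t′} → s ≈⁺ s′ → t ≈⁺ t′ → frac s t ≈ᴵ frac s′ t′
  frac-cong {s} {s′} {t} {t′} s≈ t≈ = frac-unique s′ t′
    (trans (*-congʳ (+-cong (sym s≈) (sym t≈))) (trans (frac-spec s t) s≈))

  frac-comm : ∀ s t → 1-ᴵ frac s t ≈ᴵ frac t s
  frac-comm s t = frac-unique t s (complement (+-comm (val t) (val s))
    (trans (*-congʳ (+-comm (val t) (val s))) (frac-spec s t)))

  frac-scale : ∀ r s t → frac s t ≈ᴵ frac (r *⁺ s) (r *⁺ t)
  frac-scale r s t = frac-unique (r *⁺ s) (r *⁺ t) (begin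
    (val r * val s + val r * val t) * f  ≈⟨ *-congʳ (distribˡ (val r) (val s) (val t)) ⟨
    val r * (val s + val t) * f          ≈⟨ *-assoc (val r) _ f ⟩
    val r * ((val s + val t) * f)        ≈⟨ *-congˡ (frac-spec s t) ⟩
    val r * val s                        ∎)
    where
    f : Carrier
    f = value (frac s t)

  frac-unit : ∀ p → p ≈ᴵ frac (fromUnit p) (fromUnit (1-ᴵ p))
  frac-unit p = frac-unique (fromUnit p) (fromUnit (1-ᴵ p))
    (trans (*-congʳ (x+[y-x]≈y (value p) 1#)) (*-identityˡ (value p)))

  module _ (s t u : ℝ⁺) where
    private
      p q : 𝕀
      p = frac s t
      q = frac (s +⁺ t) u

      T : Carrier
      T = val s + val t + val u

      -- The sum s + t cancels between s/(s + t) and (s + t)/T.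
      T[pq]≈s : T * (value p * value q) ≈ val s
      T[pq]≈s = begin
        T * (value p * value q)      ≈⟨ x∙yz≈xz∙y T (value p) (value q) ⟩
        T * value q * value p        ≈⟨ *-congʳ (frac-spec (s +⁺ t) u) ⟩
        (val s + val t) * value p    ≈⟨ frac-spec s t ⟩
        val s                        ∎

    frac-assocˡ : p ·ᴵ q ≈ᴵ frac s (t +⁺ u)
    frac-assocˡ = frac-unique s (t +⁺ u)
      (trans (*-congʳ (sym (+-assoc (val s) (val t) (val u)))) T[pq]≈s)

    frac-assocʳ : assocWeight p q ≈ᴵ frac t u
    frac-assocʳ = frac-unique t u (begin
      (val t + val u) * r
        -- As `p ·ᴵ q` is s/T, its complement is (t + u)/T. So t + u becomes T times the denominator
        -- of `assocWeight p q`, which then cancels.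
        ≈⟨ *-congʳ (complement (+-assoc (val s) (val t) (val u)) T[pq]≈s) ⟨
      T * (1# - value p * value q) * r    ≈⟨ *-assoc T _ r ⟩
      T * ((1# - value p * value q) * r)  ≈⟨ *-congˡ (assocWeight-left p q) ⟩
      T * ((1# - value p) * value q)      ≈⟨ x∙yz≈xz∙y T _ (value q) ⟩
      T * value q * (1# - value p)        ≈⟨ *-congʳ (frac-spec (s +⁺ t) u) ⟩
      (val s + val t) * (1# - value p)    ≈⟨ complement refl (frac-spec s t) ⟩
      val t                               ∎)
      where
      r : Carrier
      r = value (assocWeight p q)

  -- Reals as differences of positive reals.

  0<[1+n]·1 : ∀ n → 0# < ℕ.suc n · 1#
  0<[1+n]·1 ℕ.zero    = <-respʳ-≈ (sym (+-identityʳ 1#)) 0<1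
  0<[1+n]·1 (ℕ.suc n) = +-pos 0<1 (0<[1+n]·1 n)

  Decomposition : Carrier → Set (c ⊔ ℓ₁ ⊔ ℓ₂)
  Decomposition r = Σ[ p ∈ ℝ⁺ ] Σ[ q ∈ ℝ⁺ ] r + val q ≈ val p

  abstract
    decompose : ∀ r → Decomposition r
    decompose r with n , -r<n ← archimedean (- r) =
      mk⁺ (r + val q) 0<r+q , q , refl
      where
      q : ℝ⁺
      -- The successor keeps `q` positive when the Archimedean bound `n` is zero; then - r < n < q
      -- makes r + q positive.
      q = mk⁺ (ℕ.suc n · 1#) (0<[1+n]·1 n)

      n<q : n · 1# < val q
      n<q = <-respˡ-≈ (+-identityˡ _) (+-monoˡ-< (n · 1#) 0<1)

      0<r+q : 0# < r + val q
      0<r+q = <-respʳ-≈ (trans (+-congˡ (-‿involutive r)) (+-comm (val q) r))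
        (x<y⇒0<y-x (<-trans -r<n n<q))

-- From actions of the positive reals to real vector spaces.

record PositiveAction {c ℓ₁ ℓ₂ m ℓm : Level} (ℝ : RealNumbers c ℓ₁ ℓ₂) (G : AbelianGroup m ℓm)
  : Set (c ⊔ ℓ₁ ⊔ ℓ₂ ⊔ m ⊔ ℓm) where
  open PositiveReals ℝ
  open AbelianGroup G renaming (_∙_ to infixl 6 _+_)
  infixr 7 _⊛_
  field
    _⊛_         : ℝ⁺ → Carrier → Carrier
    ⊛-cong      : ∀ {p q u v} → p ≈⁺ q → u ≈ v → p ⊛ u ≈ q ⊛ v
    ⊛-distribˡ  : ∀ p u v → p ⊛ (u + v) ≈ p ⊛ u + p ⊛ v
    ⊛-distribʳ  : ∀ u p q → (p +⁺ q) ⊛ u ≈ p ⊛ u + q ⊛ u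
    ⊛-assoc     : ∀ p q u → (p *⁺ q) ⊛ u ≈ p ⊛ (q ⊛ u)
    ⊛-identity  : ∀ u → 1⁺ ⊛ u ≈ u

-- Every real is a difference p - q of positive ones, so an action of the
-- positive reals on an abelian group extends uniquely to a module structure.
module ExtendScalars {c ℓ₁ ℓ₂ m ℓm : Level} (ℝ : RealNumbers c ℓ₁ ℓ₂) (G : AbelianGroup m ℓm)
                     (action : PositiveAction ℝ G) where
  private
    module ℝ = RealNumbers ℝ
    module +ℝ = CommutativeSemigroupProperties
      (CommutativeMonoid.commutativeSemigroup
        (CommutativeRing.+-commutativeMonoid ℝ.commutativeRing))
  open PositiveReals ℝ
  open PositiveAction action
  open RealNumbers ℝ using (Carrier; _≈_; _+_; _*_; 0#; 1#; ring)
  open AbelianGroup G using ()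
    renaming ( Carrier to M; _≈_ to _≈ᴹ_; _∙_ to infixl 6 _+ᴹ_
             ; ε to 0ᴹ; _⁻¹ to -ᴹ_; _-_ to infixl 6 _-ᴹ_; ∙-cong to +ᴹ-cong; ∙-congˡ to +ᴹ-congˡ
             ; ∙-congʳ to +ᴹ-congʳ; assoc to +ᴹ-assoc; comm to +ᴹ-comm
             ; identityˡ to +ᴹ-identityˡ; setoid to ≈ᴹ-setoid
             ; refl to ≈ᴹ-refl; sym to ≈ᴹ-sym; trans to ≈ᴹ-trans)
  open AbelianGroupProperties G using (∙-cancelʳ; //-rightDividesˡ)
  open CommutativeSemigroupProperties
    (CommutativeMonoid.commutativeSemigroup (AbelianGroup.commutativeMonoid G))
    using (interchange; xy∙z≈xz∙y)
  open SetoidReasoning ≈ᴹ-setoid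

  infixr 7 _*ₗ_

  _*ₗ_ : Carrier → M → M
  r *ₗ u = let p , q , _ = decompose r in (p ⊛ u) -ᴹ (q ⊛ u)

  -- Independence of the chosen decomposition: r = p - q = p′ - q′ gives p + q′ = p′ + q, so both
  -- candidates agree after adding q u and q′ u, which cancel in the group. The module laws then
  -- reduce to exhibiting a convenient decomposition.
  *ₗ-unique : ∀ {r u w} p q → r + val q ≈ val p → w +ᴹ (q ⊛ u) ≈ᴹ (p ⊛ u) → w ≈ᴹ r *ₗ u
  *ₗ-unique {r} {u} {w} p q r+q≈p w+qu≈pu =
    ∙-cancelʳ (q′ ⊛ u) _ _ (≈ᴹ-trans
      (∙-cancelʳ (q ⊛ u) _ _ (begin
        (w +ᴹ (q′ ⊛ u)) +ᴹ (q ⊛ u)  ≈⟨ xy∙z≈xz∙y w _ _ ⟩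
        (w +ᴹ (q ⊛ u)) +ᴹ (q′ ⊛ u)  ≈⟨ +ᴹ-congʳ w+qu≈pu ⟩
        (p ⊛ u) +ᴹ (q′ ⊛ u)         ≈⟨ ⊛-distribʳ u p q′ ⟨
        (p +⁺ q′) ⊛ u               ≈⟨ ⊛-cong p+q′≈p′+q ≈ᴹ-refl ⟩
        (p′ +⁺ q) ⊛ u               ≈⟨ ⊛-distribʳ u p′ q ⟩
        (p′ ⊛ u) +ᴹ (q ⊛ u)         ∎))
      (≈ᴹ-sym (//-rightDividesˡ (q′ ⊛ u) (p′ ⊛ u))))
    where
    p′ q′ : ℝ⁺
    p′ = proj₁ (decompose r)
    q′ = proj₁ (proj₂ (decompose r))

    r+q′≈p′ : r + val q′ ≈ val p′
    r+q′≈p′ = proj₂ (proj₂ (decompose r))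

    p+q′≈p′+q : p +⁺ q′ ≈⁺ p′ +⁺ q
    p+q′≈p′+q = ℝ.trans (ℝ.+-congʳ (ℝ.sym r+q≈p))
      (ℝ.trans (+ℝ.xy∙z≈xz∙y r (val q) (val q′)) (ℝ.+-congʳ r+q′≈p′))

  -- The difference of `p ⊛ u` and `q ⊛ u` satisfies the hypothesis of `*ₗ-unique`.
  *ₗ-spec : ∀ {r} u p q → r + val q ≈ val p → r *ₗ u +ᴹ (q ⊛ u) ≈ᴹ (p ⊛ u)
  *ₗ-spec u p q r+q≈p = ≈ᴹ-trans
    (+ᴹ-congʳ (≈ᴹ-sym (*ₗ-unique p q r+q≈p (//-rightDividesˡ (q ⊛ u) (p ⊛ u)))))
    (//-rightDividesˡ (q ⊛ u) (p ⊛ u))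

  -- A positive p decomposes as (p + 1) - 1.
  ⊛≈*ₗ : ∀ p u → (p ⊛ u) ≈ᴹ val p *ₗ u
  ⊛≈*ₗ p u = *ₗ-unique (p +⁺ 1⁺) 1⁺ ℝ.refl (≈ᴹ-sym (⊛-distribʳ u p 1⁺))

  *ₗ-cong : ∀ {r s u v} → r ≈ s → u ≈ᴹ v → r *ₗ u ≈ᴹ s *ₗ v
  *ₗ-cong {r} {s} {u} {v} r≈s u≈v = helper (decompose r)
    where
    -- The decomposition is an arbitrary one, unrelated to the one inside `r *ₗ u`; `*ₗ-spec` holds
    -- for all of them.
    helper : Decomposition r → r *ₗ u ≈ᴹ s *ₗ v
    helper (p , q , r+q≈p) = *ₗ-unique p q (ℝ.trans (ℝ.+-congʳ (ℝ.sym r≈s)) r+q≈p) (begin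
      r *ₗ u +ᴹ (q ⊛ v)  ≈⟨ +ᴹ-congˡ (⊛-cong ℝ.refl u≈v) ⟨
      r *ₗ u +ᴹ (q ⊛ u)  ≈⟨ *ₗ-spec u p q r+q≈p ⟩
      p ⊛ u              ≈⟨ ⊛-cong ℝ.refl u≈v ⟩
      p ⊛ v              ∎)

  *ₗ-zeroˡ : ∀ u → 0# *ₗ u ≈ᴹ 0ᴹ
  *ₗ-zeroˡ u = ≈ᴹ-sym (*ₗ-unique 1⁺ 1⁺ (ℝ.+-identityˡ 1#) (+ᴹ-identityˡ _))

  *ₗ-identityˡ : ∀ u → 1# *ₗ u ≈ᴹ u
  *ₗ-identityˡ u = ≈ᴹ-trans (≈ᴹ-sym (⊛≈*ₗ 1⁺ u)) (⊛-identity u)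

  *ₗ-distribʳ : ∀ u r s → (r + s) *ₗ u ≈ᴹ r *ₗ u +ᴹ s *ₗ u
  *ₗ-distribʳ u r s = helper (decompose r) (decompose s)
    where
    helper : Decomposition r →
             Decomposition s →
             (r + s) *ₗ u ≈ᴹ r *ₗ u +ᴹ s *ₗ u
    helper (p , q , r+q≈p) (p′ , q′ , s+q′≈p′) = ≈ᴹ-sym (*ₗ-unique (p +⁺ p′) (q +⁺ q′)
      (ℝ.trans (+ℝ.interchange r s (val q) (val q′)) (ℝ.+-cong r+q≈p s+q′≈p′))
      (begin
        (r *ₗ u +ᴹ s *ₗ u) +ᴹ ((q +⁺ q′) ⊛ u)           ≈⟨ +ᴹ-congˡ (⊛-distribʳ u q q′) ⟩
        (r *ₗ u +ᴹ s *ₗ u) +ᴹ ((q ⊛ u) +ᴹ (q′ ⊛ u))     ≈⟨ interchange _ _ _ _ ⟩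
        (r *ₗ u +ᴹ (q ⊛ u)) +ᴹ (s *ₗ u +ᴹ (q′ ⊛ u))
          ≈⟨ +ᴹ-cong (*ₗ-spec u p q r+q≈p) (*ₗ-spec u p′ q′ s+q′≈p′) ⟩
        (p ⊛ u) +ᴹ (p′ ⊛ u)                             ≈⟨ ⊛-distribʳ u p p′ ⟨
        (p +⁺ p′) ⊛ u                                   ∎))

  *ₗ-distribˡ : ∀ r u v → r *ₗ (u +ᴹ v) ≈ᴹ r *ₗ u +ᴹ r *ₗ v
  *ₗ-distribˡ r u v = helper (decompose r)
    where
    helper : Decomposition r →
             r *ₗ (u +ᴹ v) ≈ᴹ r *ₗ u +ᴹ r *ₗ v
    helper (p , q , r+q≈p) = ≈ᴹ-sym (*ₗ-unique p q r+q≈p (begin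
      (r *ₗ u +ᴹ r *ₗ v) +ᴹ (q ⊛ (u +ᴹ v))           ≈⟨ +ᴹ-congˡ (⊛-distribˡ q u v) ⟩
      (r *ₗ u +ᴹ r *ₗ v) +ᴹ ((q ⊛ u) +ᴹ (q ⊛ v))     ≈⟨ interchange _ _ _ _ ⟩
      (r *ₗ u +ᴹ (q ⊛ u)) +ᴹ (r *ₗ v +ᴹ (q ⊛ v))
        ≈⟨ +ᴹ-cong (*ₗ-spec u p q r+q≈p) (*ₗ-spec v p q r+q≈p) ⟩
      (p ⊛ u) +ᴹ (p ⊛ v)                             ≈⟨ ⊛-distribˡ p u v ⟨
      p ⊛ (u +ᴹ v)                                   ∎))

  *ₗ-zeroʳ : ∀ r → r *ₗ 0ᴹ ≈ᴹ 0ᴹ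
  *ₗ-zeroʳ r = ∙-cancelʳ (r *ₗ 0ᴹ) _ _ (begin
    r *ₗ 0ᴹ +ᴹ r *ₗ 0ᴹ  ≈⟨ *ₗ-distribˡ r 0ᴹ 0ᴹ ⟨
    r *ₗ (0ᴹ +ᴹ 0ᴹ)     ≈⟨ *ₗ-cong ℝ.refl (+ᴹ-identityˡ 0ᴹ) ⟩
    r *ₗ 0ᴹ             ≈⟨ +ᴹ-identityˡ _ ⟨
    0ᴹ +ᴹ r *ₗ 0ᴹ       ∎)

  -- (p - q)(p′ - q′) = (p p′ + q q′) - (q p′ + p q′)
  *ₗ-assoc : ∀ r s u → (r * s) *ₗ u ≈ᴹ r *ₗ (s *ₗ u)
  *ₗ-assoc r s u = helper (decompose r) (decompose s)
    where
    helper : Decomposition r →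
             Decomposition s →
             (r * s) *ₗ u ≈ᴹ r *ₗ (s *ₗ u)
    helper (p , q , r+q≈p) (p′ , q′ , s+q′≈p′) = ≈ᴹ-sym
      (*ₗ-unique ((p *⁺ p′) +⁺ (q *⁺ q′)) ((q *⁺ p′) +⁺ (p *⁺ q′)) weights (begin
        r *ₗ v +ᴹ (((q *⁺ p′) +⁺ (p *⁺ q′)) ⊛ u)
          ≈⟨ +ᴹ-congˡ (⊛-distribʳ u _ _) ⟩
        r *ₗ v +ᴹ (((q *⁺ p′) ⊛ u) +ᴹ ((p *⁺ q′) ⊛ u))
          ≈⟨ +ᴹ-congˡ (+ᴹ-cong (split q) (⊛-assoc p q′ u)) ⟩
        r *ₗ v +ᴹ (((q ⊛ v) +ᴹ ((q *⁺ q′) ⊛ u)) +ᴹ (p ⊛ (q′ ⊛ u)))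
          ≈⟨ +ᴹ-congˡ (+ᴹ-assoc _ _ _) ⟩
        r *ₗ v +ᴹ ((q ⊛ v) +ᴹ (((q *⁺ q′) ⊛ u) +ᴹ (p ⊛ (q′ ⊛ u))))
          ≈⟨ +ᴹ-assoc _ _ _ ⟨
        (r *ₗ v +ᴹ (q ⊛ v)) +ᴹ (((q *⁺ q′) ⊛ u) +ᴹ (p ⊛ (q′ ⊛ u)))
          ≈⟨ +ᴹ-cong (*ₗ-spec v p q r+q≈p) (+ᴹ-comm _ _) ⟩
        (p ⊛ v) +ᴹ ((p ⊛ (q′ ⊛ u)) +ᴹ ((q *⁺ q′) ⊛ u))
          ≈⟨ +ᴹ-assoc _ _ _ ⟨
        ((p ⊛ v) +ᴹ (p ⊛ (q′ ⊛ u))) +ᴹ ((q *⁺ q′) ⊛ u)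
          ≈⟨ +ᴹ-congʳ (merge p) ⟨
        ((p *⁺ p′) ⊛ u) +ᴹ ((q *⁺ q′) ⊛ u)
          ≈⟨ ⊛-distribʳ u _ _ ⟨
        ((p *⁺ p′) +⁺ (q *⁺ q′)) ⊛ u ∎))
      where
      v : M
      v = s *ₗ u

      merge : ∀ t → ((t *⁺ p′) ⊛ u) ≈ᴹ (t ⊛ v) +ᴹ (t ⊛ (q′ ⊛ u))
      merge t = begin
        (t *⁺ p′) ⊛ u                ≈⟨ ⊛-assoc t p′ u ⟩
        t ⊛ (p′ ⊛ u)                 ≈⟨ ⊛-cong ℝ.refl (*ₗ-spec u p′ q′ s+q′≈p′) ⟨
        t ⊛ (v +ᴹ (q′ ⊛ u))          ≈⟨ ⊛-distribˡ t v _ ⟩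
        (t ⊛ v) +ᴹ (t ⊛ (q′ ⊛ u))    ∎

      split : ∀ t → ((t *⁺ p′) ⊛ u) ≈ᴹ (t ⊛ v) +ᴹ ((t *⁺ q′) ⊛ u)
      split t = ≈ᴹ-trans (merge t) (+ᴹ-congˡ (≈ᴹ-sym (⊛-assoc t q′ u)))

      weights : r * s + (val q * val p′ + val p * val q′) ≈ val p * val p′ + val q * val q′
      weights = ℝ.trans
        (ℝ.+-congˡ (ℝ.+-cong (ℝ.*-congˡ (ℝ.sym s+q′≈p′)) (ℝ.*-congʳ (ℝ.sym r+q≈p))))
        (ℝ.trans
          (solve 4 (λ r s q q′ → r :* s :+ (q :* (s :+ q′) :+ (r :+ q) :* q′)
                              := (r :+ q) :* (s :+ q′) :+ q :* q′) ℝ.refl r s (val q) (val q′))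
          (ℝ.+-congʳ (ℝ.*-cong r+q≈p s+q′≈p′)))
        where open SemiringSolver (CommutativeRing.commutativeSemiring ℝ.commutativeRing)

  leftModule : LeftModule ring m ℓm
  leftModule = record
    { _*ₗ_ = _*ₗ_
    ; isLeftModule = record
      { isLeftSemimodule = record
        { +ᴹ-isCommutativeMonoid = AbelianGroup.isCommutativeMonoid G
        ; isPreleftSemimodule = record
          { *ₗ-cong      = *ₗ-cong
          ; *ₗ-zeroˡ     = *ₗ-zeroˡ
          ; *ₗ-distribʳ  = *ₗ-distribʳ
          ; *ₗ-identityˡ = *ₗ-identityˡ
          ; *ₗ-assoc     = *ₗ-assoc
          ; *ₗ-zeroʳ     = *ₗ-zeroʳ
          ; *ₗ-distribˡ  = *ₗ-distribˡ
          }
        }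
      ; -ᴹ‿cong    = AbelianGroup.⁻¹-cong G
      ; -ᴹ‿inverse = AbelianGroup.inverse G
      }
    }

-- The ordered cone over a cancellative convex semilattice.

module Cone {c ℓ₁ ℓ₂ a ℓ : Level} (ℝ : RealNumbers c ℓ₁ ℓ₂) (𝕏 : ConvexSemilattice ℝ a ℓ)
            (cancel : Cancellative ℝ 𝕏) where
  private
    module ℝ = RealNumbers ℝ
    module X = ConvexSemilattice 𝕏
    module ≈X = IsSemilattice X._≈_ X.isSemilattice
  open OpenUnitInterval ℝ
  open PositiveReals ℝ
  open AbelianGroupProperties (CommutativeRing.+-abelianGroup ℝ.commutativeRing)
    using (∙-cancelʳ)
  open X using (_⊕_; _+⟨_⟩_) renaming (_≈_ to _≈ˣ_)

  infix  4 _≈_ _≤_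
  infixl 6 _+_

  -- The cone over X: ray t x stands for the multiple t · x.
  record Ray : Set (c ⊔ ℓ₂ ⊔ a) where
    constructor ray
    field
      weight : ℝ⁺
      point  : X.Carrier

  open Ray public

  record _≈_ (k l : Ray) : Set (c ⊔ ℓ₁ ⊔ ℓ₂ ⊔ a ⊔ ℓ) where
    constructor mk≈
    field
      weight≈ : weight k ≈⁺ weight l
      point≈  : point k ≈ˣ point l

  -- Only rays of equal weight are comparable.
  record _≤_ (k l : Ray) : Set (c ⊔ ℓ₁ ⊔ ℓ₂ ⊔ a ⊔ ℓ) where
    constructor mk≤
    field
      weight≈ : weight k ≈⁺ weight l
      point≤  : point k ⊕ point l ≈ˣ point l

  -- The point of s x + t y after division by the total weight s + t.
  mix : ℝ⁺ → ℝ⁺ → X.Carrier → X.Carrier → X.Carrier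
  mix s t x y = x +⟨ frac s t ⟩ y

  _+_ : Ray → Ray → Ray
  ray s x + ray t y = ray (s +⁺ t) (mix s t x y)

  scale : ℝ⁺ → Ray → Ray
  scale r (ray t x) = ray (r *⁺ t) x

  +⟨⟩-congʷ : ∀ {p q x y} → p ≈ᴵ q → x +⟨ p ⟩ y ≈ˣ x +⟨ q ⟩ y
  +⟨⟩-congʷ {p} {q} p≈q = X.+-cong {p = p} {p′ = q} ≈X.refl p≈q ≈X.refl

  mix-cong : ∀ {s s′ t t′ x x′ y y′} →
    s ≈⁺ s′ → t ≈⁺ t′ → x ≈ˣ x′ → y ≈ˣ y′ → mix s t x y ≈ˣ mix s′ t′ x′ y′
  mix-cong {s} {s′} {t} {t′} s≈ t≈ x≈ y≈ =
    X.+-cong {p = frac s t} {p′ = frac s′ t′} x≈ (frac-cong {s} {s′} {t} {t′} s≈ t≈) y≈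

  +-commutativeSemigroup : CommutativeSemigroup (c ⊔ ℓ₂ ⊔ a) (c ⊔ ℓ₁ ⊔ ℓ₂ ⊔ a ⊔ ℓ)
  +-commutativeSemigroup = record
    { Carrier = Ray
    ; _≈_ = _≈_
    ; _∙_ = _+_
    ; isCommutativeSemigroup = record
      { isSemigroup = record
        { isMagma = record
          { isEquivalence = record
            { refl  = mk≈ ℝ.refl ≈X.refl
            ; sym   = λ (mk≈ w p) → mk≈ (ℝ.sym w) (≈X.sym p)
            ; trans = λ (mk≈ w p) (mk≈ w′ p′) → mk≈ (ℝ.trans w w′) (≈X.trans p p′)
            }
          ; ∙-cong = λ {k} {k′} {l} {l′} (mk≈ w p) (mk≈ w′ p′) →
              mk≈ (ℝ.+-cong w w′)
                (mix-cong {weight k} {weight k′} {weight l} {weight l′} w w′ p p′)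
          }
        -- Parametric associativity turns into associativity of sums once its two weights are
        -- recognised as s/(s + (t + u)) and t/(t + u).
        ; assoc = λ (ray s x) (ray t y) (ray u z) → mk≈ (ℝ.+-assoc _ _ _)
            (≈X.trans (X.+-assoc x y z (frac s t) (frac (s +⁺ t) u))
              (X.+-cong {p = frac s t ·ᴵ frac (s +⁺ t) u} {p′ = frac s (t +⁺ u)}
                ≈X.refl (frac-assocˡ s t u)
                (+⟨⟩-congʷ {assocWeight (frac s t) (frac (s +⁺ t) u)} {frac t u}
                  (frac-assocʳ s t u))))
        }
      ; comm = λ (ray s x) (ray t y) → mk≈ (ℝ.+-comm _ _)
          (≈X.trans (X.+-comm x y (frac s t))
            (+⟨⟩-congʷ {1-ᴵ frac s t} {frac t s} (frac-comm s t)))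
      }
    }

  open CommutativeSemigroup +-commutativeSemigroup public
    using (refl; sym; trans)
    renaming (∙-cong to +-cong; ∙-congʳ to +-congʳ; comm to +-comm)

  -- The weights are cancelled first, in the reals. Only then are both points combined with `z` at
  -- the same parameter, as cancellativity of X demands.
  +-cancelʳ : ∀ {k l} m → k + m ≈ l + m → k ≈ l
  +-cancelʳ {ray s x} {ray t y} (ray u z) (mk≈ w p) = mk≈ s≈t
    (cancel x y z (frac s u)
      (≈X.trans p (mix-cong {t} {s} {u} {u} (ℝ.sym s≈t) ℝ.refl ≈X.refl ≈X.refl)))
    where
    s≈t : s ≈⁺ t
    s≈t = ∙-cancelʳ (val u) _ _ w

  scale-cong : ∀ {p q k l} → p ≈⁺ q → k ≈ l → scale p k ≈ scale q l
  scale-cong p≈q (mk≈ w x) = mk≈ (ℝ.*-cong p≈q w) x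

  scale-distribˡ : ∀ p k l → scale p (k + l) ≈ scale p k + scale p l
  scale-distribˡ p (ray s x) (ray t y) = mk≈ (ℝ.distribˡ _ _ _)
    (+⟨⟩-congʷ {frac s t} {frac (p *⁺ s) (p *⁺ t)} (frac-scale p s t))

  -- Both summands lie over the same point, so this is idempotence.
  scale-distribʳ : ∀ k p q → scale (p +⁺ q) k ≈ scale p k + scale q k
  scale-distribʳ (ray s x) p q = mk≈ (ℝ.distribʳ _ _ _) (≈X.sym (X.+-idem x _))

  ≤-reflexive : ∀ {k l} → k ≈ l → k ≤ l
  ≤-reflexive (mk≈ w p) = mk≤ w (≈X.trans (≈X.∙-congʳ p) (≈X.idem _))

  ≤-trans : ∀ {k l m} → k ≤ l → l ≤ m → k ≤ m
  ≤-trans {ray _ x} {ray _ y} {ray _ z} (mk≤ w p) (mk≤ w′ p′) = mk≤ (ℝ.trans w w′) (begin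
    x ⊕ z        ≈⟨ ≈X.∙-congˡ p′ ⟨
    x ⊕ (y ⊕ z)  ≈⟨ ≈X.assoc x y z ⟨
    (x ⊕ y) ⊕ z  ≈⟨ ≈X.∙-congʳ p ⟩
    y ⊕ z        ≈⟨ p′ ⟩
    z            ∎)
    where open SetoidReasoning ≈X.setoid

  ≤-antisym : ∀ {k l} → k ≤ l → l ≤ k → k ≈ l
  ≤-antisym (mk≤ w p) (mk≤ _ p′) = mk≈ w (≈X.trans (≈X.sym p′) (≈X.trans (≈X.comm _ _) p))

  ≤-poset : Poset (c ⊔ ℓ₂ ⊔ a) (c ⊔ ℓ₁ ⊔ ℓ₂ ⊔ a ⊔ ℓ) (c ⊔ ℓ₁ ⊔ ℓ₂ ⊔ a ⊔ ℓ)
  ≤-poset = record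
    { isPartialOrder = record
      { isPreorder = record
        { isEquivalence = CommutativeSemigroup.isEquivalence +-commutativeSemigroup
        ; reflexive     = ≤-reflexive
        ; trans         = ≤-trans
        }
      ; antisym = ≤-antisym
      }
    }

  +-monoˡ-≤ : ∀ {k l} m → k ≤ l → k + m ≤ l + m
  +-monoˡ-≤ {ray s x} {ray t y} (ray u z) (mk≤ w p) = mk≤ (ℝ.+-congʳ w) (begin
    mix s u x z ⊕ mix t u y z
      ≈⟨ ≈X.∙-congʳ (mix-cong {s} {t} {u} {u} w ℝ.refl ≈X.refl ≈X.refl) ⟩
    mix t u x z ⊕ mix t u y z  ≈⟨ X.+-distribʳ-⊕ x y z _ ⟨
    mix t u (x ⊕ y) z          ≈⟨ mix-cong {t} {t} {u} {u} ℝ.refl ℝ.refl p ≈X.refl ⟩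
    mix t u y z                ∎)
    where open SetoidReasoning ≈X.setoid

  -- An inequality is an equation x ⊕ y = y. Distributivity presents the hypothesis as an equation
  -- between combinations of x ⊕ y and of y with z, to which cancellativity applies.
  +-cancelʳ-≤ : ∀ {k l} m → k + m ≤ l + m → k ≤ l
  +-cancelʳ-≤ {ray s x} {ray t y} (ray u z) (mk≤ w p) = mk≤ s≈t
    (cancel (x ⊕ y) y z (frac t u) (begin
      mix t u (x ⊕ y) z          ≈⟨ X.+-distribʳ-⊕ x y z _ ⟩
      mix t u x z ⊕ mix t u y z
        ≈⟨ ≈X.∙-congʳ (mix-cong {t} {s} {u} {u} (ℝ.sym s≈t) ℝ.refl ≈X.refl ≈X.refl) ⟩
      mix s u x z ⊕ mix t u y z  ≈⟨ p ⟩
      mix t u y z                ∎))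
    where
    open SetoidReasoning ≈X.setoid

    s≈t : s ≈⁺ t
    s≈t = ∙-cancelʳ (val u) _ _ w

  scale-mono-≤ : ∀ p {k l} → k ≤ l → scale p k ≤ scale p l
  scale-mono-≤ p (mk≤ w x≤y) = mk≤ (ℝ.*-congˡ w) x≤y

  x≤x⊕y : ∀ t x y → ray t x ≤ ray t (x ⊕ y)
  x≤x⊕y t x y = mk≤ ℝ.refl (≈X.trans (≈X.sym (≈X.assoc x x y)) (≈X.∙-congʳ (≈X.idem x)))

  y≤x⊕y : ∀ t x y → ray t y ≤ ray t (x ⊕ y)
  y≤x⊕y t x y = ≤-trans (x≤x⊕y t y x) (≤-reflexive (mk≈ ℝ.refl (≈X.comm y x)))

  -- By distributivity, adding `k` preserves suprema of rays of equal weight. The summand is there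
  -- because comparing a difference with `w` adds the subtrahend of `w`.
  +-⊕-least : ∀ t x y k {l} → ray t x + k ≤ l → ray t y + k ≤ l → ray t (x ⊕ y) + k ≤ l
  +-⊕-least t x y (ray u z) {ray v l} (mk≤ w p) (mk≤ _ q) = mk≤ w (begin
    mix t u (x ⊕ y) z ⊕ l              ≈⟨ ≈X.∙-congʳ (X.+-distribʳ-⊕ x y z _) ⟩
    (mix t u x z ⊕ mix t u y z) ⊕ l    ≈⟨ ≈X.assoc _ _ _ ⟩
    mix t u x z ⊕ (mix t u y z ⊕ l)    ≈⟨ ≈X.∙-congˡ q ⟩
    mix t u x z ⊕ l                    ≈⟨ p ⟩
    l                                  ∎)
    where open SetoidReasoning ≈X.setoid

-- The Riesz space of differences of rays of equal weight.

module Differences {c ℓ₁ ℓ₂ a ℓ : Level} (ℝ : RealNumbers c ℓ₁ ℓ₂)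
                   (𝕏 : ConvexSemilattice ℝ a ℓ) (cancel : Cancellative ℝ 𝕏) where
  private
    module ℝ = RealNumbers ℝ
    module X = ConvexSemilattice 𝕏
    module X≈ = IsEquivalence X.isEquivalence
    module K = Cone ℝ 𝕏 cancel
  open PositiveReals ℝ
  open X using (_⊕_)
  open K using (Ray; ray; mix)
  open CommutativeSemigroupProperties K.+-commutativeSemigroup
    using (interchange; xy∙z≈xz∙y; xy∙z≈y∙xz)
  open PosetReasoning K.≤-poset

  infix  4 _≈_ _≤_
  infixl 6 _+_
  infixr 7 _∨_ _∧_
  infixr 8 -_

  -- With one weight for both rays, these are the formal differences of total weight zero. Hence the
  -- crossed sums of two of them have equal weight, without which they would not be comparable.
  record Diff : Set (c ⊔ ℓ₁ ⊔ ℓ₂ ⊔ a ⊔ ℓ) where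
    constructor diff
    field
      weight : ℝ⁺
      plus   : X.Carrier
      minus  : X.Carrier

    pos neg : Ray
    pos = ray weight plus
    neg = ray weight minus

  open Diff using (pos; neg)

  -- The subtrahends are moved across, so that only sums of rays are compared. The record lets `u`
  -- and `v` be inferred from the type.
  record _≤_ (u v : Diff) : Set (c ⊔ ℓ₁ ⊔ ℓ₂ ⊔ a ⊔ ℓ) where
    constructor mk≤
    field
      cross : pos u K.+ neg v K.≤ pos v K.+ neg u

  open _≤_

  -- Mutual inequality makes antisymmetry hold by definition. Since rays are partially ordered, it
  -- amounts to the usual equality of crossed sums.
  _≈_ : Rel Diff (c ⊔ ℓ₁ ⊔ ℓ₂ ⊔ a ⊔ ℓ)
  _≈_ = Sym.SymInterior _≤_

  cross-≈ : ∀ {u v} → pos u K.+ neg v K.≈ pos v K.+ neg u → u ≈ v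
  cross-≈ e = mk≤ (K.≤-reflexive e) Sym., mk≤ (K.≤-reflexive (K.sym e))

  parts-≈ : ∀ {u v} → pos u K.≈ pos v → neg u K.≈ neg v → u ≈ v
  parts-≈ p n = cross-≈ (K.+-cong p (K.sym n))

  ≤-refl : ∀ {u} → u ≤ u
  ≤-refl = mk≤ (K.≤-reflexive K.refl)

  -- Adding `neg v` to both sides lets the two hypotheses be chained; removing it again is where
  -- cancellativity enters.
  ≤-trans : ∀ {u v w} → u ≤ v → v ≤ w → u ≤ w
  ≤-trans {u} {v} {w} (mk≤ u≤v) (mk≤ v≤w) = mk≤ (K.+-cancelʳ-≤ (neg v) (begin
    pos u K.+ neg w K.+ neg v  ≈⟨ xy∙z≈xz∙y _ _ _ ⟩
    pos u K.+ neg v K.+ neg w  ≤⟨ K.+-monoˡ-≤ (neg w) u≤v ⟩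
    pos v K.+ neg u K.+ neg w  ≈⟨ xy∙z≈xz∙y _ _ _ ⟩
    pos v K.+ neg w K.+ neg u  ≤⟨ K.+-monoˡ-≤ (neg u) v≤w ⟩
    pos w K.+ neg v K.+ neg u  ≈⟨ xy∙z≈xz∙y _ _ _ ⟩
    pos w K.+ neg u K.+ neg v  ∎))

  ≈-sym : ∀ {u v} → u ≈ v → v ≈ u
  ≈-sym = Sym.symmetric

  ≈-trans : ∀ {u v w} → u ≈ v → v ≈ w → u ≈ w
  ≈-trans = Sym.transitive ≤-trans

  _+_ : Diff → Diff → Diff
  diff s x y + diff t z w = diff (s +⁺ t) (mix s t x z) (mix s t y w)

  -_ : Diff → Diff
  - diff t x y = diff t y x

  scale : ℝ⁺ → Diff → Diff
  scale r (diff t x y) = diff (r *⁺ t) x y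

  +-comm : ∀ u v → u + v ≈ v + u
  +-comm u v = parts-≈ (K.+-comm (pos u) (pos v)) (K.+-comm (neg u) (neg v))

  +-assoc : ∀ u v w → u + v + w ≈ u + (v + w)
  +-assoc u v w = parts-≈ (assoc (pos u) (pos v) (pos w)) (assoc (neg u) (neg v) (neg w))
    where open CommutativeSemigroup K.+-commutativeSemigroup using (assoc)

  +-monoˡ : ∀ {u v} w → u ≤ v → u + w ≤ v + w
  +-monoˡ {u} {v} w (mk≤ u≤v) = mk≤ (begin
    (pos u K.+ pos w) K.+ (neg v K.+ neg w)  ≈⟨ interchange _ _ _ _ ⟩
    (pos u K.+ neg v) K.+ (pos w K.+ neg w)  ≤⟨ K.+-monoˡ-≤ _ u≤v ⟩
    (pos v K.+ neg u) K.+ (pos w K.+ neg w)  ≈⟨ interchange _ _ _ _ ⟩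
    (pos v K.+ pos w) K.+ (neg u K.+ neg w)  ∎)

  +-mono : ∀ {u u′ v v′} → u ≤ u′ → v ≤ v′ → u + v ≤ u′ + v′
  +-mono {u} {u′} {v} {v′} u≤u′ v≤v′ = ≤-trans (+-monoˡ v u≤u′)
    (≤-trans (Sym.lhs≤rhs (+-comm u′ v)) (≤-trans (+-monoˡ u′ v≤v′) (Sym.lhs≤rhs (+-comm v′ u′))))

  -‿anti : ∀ {u v} → u ≤ v → - v ≤ - u
  -‿anti {u} {v} (mk≤ u≤v) = mk≤ (begin
    neg v K.+ pos u  ≈⟨ K.+-comm _ _ ⟩
    pos u K.+ neg v  ≤⟨ u≤v ⟩
    pos v K.+ neg u  ≈⟨ K.+-comm _ _ ⟩
    neg u K.+ pos v  ∎)

  scale-mono : ∀ p {u v} → u ≤ v → scale p u ≤ scale p v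
  scale-mono p {u} {v} (mk≤ u≤v) = mk≤ (begin
    K.scale p (pos u) K.+ K.scale p (neg v)  ≈⟨ K.scale-distribˡ p (pos u) (neg v) ⟨
    K.scale p (pos u K.+ neg v)              ≤⟨ K.scale-mono-≤ p u≤v ⟩
    K.scale p (pos v K.+ neg u)              ≈⟨ K.scale-distribˡ p (pos v) (neg u) ⟩
    K.scale p (pos v) K.+ K.scale p (neg u)  ∎)

  scale-cong : ∀ {p q u v} → p ≈⁺ q → u ≈ v → scale p u ≈ scale q v
  scale-cong {p} {q} {u} {v} p≈q (u≤v Sym., v≤u) =
    ≈-trans (scale-mono p u≤v Sym., scale-mono p v≤u)
      (parts-≈ (K.scale-cong {p} {q} p≈q K.refl) (K.scale-cong {p} {q} p≈q K.refl))

  -- Every `diff t x x` represents zero. Adding one changes the weight and the subtrahend of a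
  -- representative but not the element.
  null-+ : ∀ t x u → diff t x x + u ≈ u
  null-+ t x u = cross-≈ (xy∙z≈y∙xz (ray t x) (pos u) (neg u))

  join : ℝ⁺ → X.Carrier → X.Carrier → X.Carrier → Diff
  join t x y b = diff t (x ⊕ y) b

  x≤join : ∀ t x y b → diff t x b ≤ join t x y b
  x≤join t x y b = mk≤ (K.+-monoˡ-≤ (ray t b) (K.x≤x⊕y t x y))

  y≤join : ∀ t x y b → diff t y b ≤ join t x y b
  y≤join t x y b = mk≤ (K.+-monoˡ-≤ (ray t b) (K.y≤x⊕y t x y))

  join-least : ∀ t x y b {w} → diff t x b ≤ w → diff t y b ≤ w → join t x y b ≤ w
  join-least t x y b {w} (mk≤ x≤w) (mk≤ y≤w) = mk≤ (K.+-⊕-least t x y (neg w) x≤w y≤w)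

  -- Differences a - b and c - d are rewritten as (a + d) - (b + d) and (b + c) - (b + d), which
  -- share weight and subtrahend, so that `join` applies.
  _∨_ _∧_ : Diff → Diff → Diff
  diff s x y ∨ diff t z w = join (s +⁺ t) (mix s t x w) (mix s t y z) (mix s t y w)
  u ∧ v = - (- u ∨ - v)

  -- The two arguments of a supremum, brought to the subtrahend neg u + neg v.
  commonˡ : ∀ s x y t w → diff s x y ≈ diff (s +⁺ t) (mix s t x w) (mix s t y w)
  commonˡ s x y t w = ≈-sym (≈-trans (+-comm u (diff t w w)) (null-+ t w u))
    where
    u : Diff
    u = diff s x y

  commonʳ : ∀ s y t z w → diff t z w ≈ diff (s +⁺ t) (mix s t y z) (mix s t y w)
  commonʳ s y t z w = ≈-sym (null-+ s y (diff t z w))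

  u≤u∨v : ∀ u v → u ≤ u ∨ v
  u≤u∨v (diff s x y) (diff t z w) =
    ≤-trans (Sym.lhs≤rhs (commonˡ s x y t w)) (x≤join _ _ _ _)

  v≤u∨v : ∀ u v → v ≤ u ∨ v
  v≤u∨v (diff s x y) (diff t z w) =
    ≤-trans (Sym.lhs≤rhs (commonʳ s y t z w)) (y≤join _ _ _ _)

  ∨-least : ∀ u v {m} → u ≤ m → v ≤ m → u ∨ v ≤ m
  ∨-least (diff s x y) (diff t z w) u≤m v≤m = join-least _ _ _ _
    (≤-trans (Sym.rhs≤lhs (commonˡ s x y t w)) u≤m)
    (≤-trans (Sym.rhs≤lhs (commonʳ s y t z w)) v≤m)

  isLattice : IsLattice _≈_ _≤_ _∨_ _∧_
  isLattice = record
    { isPartialOrder = Sym.isPartialOrder ≤-refl ≤-trans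
    ; supremum = λ u v → u≤u∨v u v , v≤u∨v u v , λ _ → ∨-least u v
    ; infimum  = λ u v → -‿anti (u≤u∨v (- u) (- v)) , -‿anti (v≤u∨v (- u) (- v))
                       , λ _ m≤u m≤v → -‿anti (∨-least (- u) (- v) (-‿anti m≤u) (-‿anti m≤v))
    }

  -- The base point supplies a representative of zero; the order, the sum and the lattice operations
  -- are already defined independently of it.
  module Based (b : X.Carrier) where
    +-abelianGroup : AbelianGroup (c ⊔ ℓ₁ ⊔ ℓ₂ ⊔ a ⊔ ℓ) (c ⊔ ℓ₁ ⊔ ℓ₂ ⊔ a ⊔ ℓ)
    +-abelianGroup = record
      { Carrier = Diff
      ; _≈_ = _≈_
      ; _∙_ = _+_
      ; ε   = diff 1⁺ b b
      ; _⁻¹ = -_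
      ; isAbelianGroup = record
        { isGroup = record
          { isMonoid = record
            { isSemigroup = record
              { isMagma = record
                { isEquivalence = Sym.isEquivalence ≤-refl ≤-trans
                ; ∙-cong = λ (u≤ Sym., u≥) (v≤ Sym., v≥) → +-mono u≤ v≤ Sym., +-mono u≥ v≥
                }
              ; assoc = +-assoc
              }
            ; identity = null-+ 1⁺ b , λ u → ≈-trans (+-comm u _) (null-+ 1⁺ b u)
            }
          ; inverse = inverseˡ , λ u → ≈-trans (+-comm u (- u)) (inverseˡ u)
          ; ⁻¹-cong = λ (u≤ Sym., u≥) → -‿anti u≥ Sym., -‿anti u≤
          }
        ; comm = +-comm
        }
      }
      where
      inverseˡ : ∀ u → - u + u ≈ diff 1⁺ b b
      inverseˡ u = cross-≈ (K.trans (K.+-congʳ (K.+-comm (neg u) (pos u))) (K.+-comm _ _))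

    scaleAction : PositiveAction ℝ +-abelianGroup
    scaleAction = record
      { _⊛_        = scale
      ; ⊛-cong     = λ {p} {q} → scale-cong {p} {q}
      ; ⊛-distribˡ = λ p u v → parts-≈
          (K.scale-distribˡ p (pos u) (pos v)) (K.scale-distribˡ p (neg u) (neg v))
      ; ⊛-distribʳ = λ u p q → parts-≈
          (K.scale-distribʳ (pos u) p q) (K.scale-distribʳ (neg u) p q)
      ; ⊛-assoc    = λ p q u → parts-≈
          (K.mk≈ (ℝ.*-assoc _ _ _) X≈.refl) (K.mk≈ (ℝ.*-assoc _ _ _) X≈.refl)
      ; ⊛-identity = λ u → parts-≈
          (K.mk≈ (ℝ.*-identityˡ _) X≈.refl) (K.mk≈ (ℝ.*-identityˡ _) X≈.refl)
      }

    module Scalars = ExtendScalars ℝ +-abelianGroup scaleAction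

    rieszSpace : RieszSpace ℝ (c ⊔ ℓ₁ ⊔ ℓ₂ ⊔ a ⊔ ℓ) (c ⊔ ℓ₁ ⊔ ℓ₂ ⊔ a ⊔ ℓ) (c ⊔ ℓ₁ ⊔ ℓ₂ ⊔ a ⊔ ℓ)
    rieszSpace = record
      { vectorSpace = Scalars.leftModule
      ; _≤_ = _≤_
      ; _∨_ = _∨_
      ; _∧_ = _∧_
      ; isLattice = isLattice
      ; +ᴹ-monoˡ = +-monoˡ
      ; *ₗ-pos = λ {u} {q} 0<q 0≤u → ≤-trans (≤-trans
          -- Scaling zero by `q` gives the representative of zero of weight q, so 0 ≤ q 0 ≤ q u.
          (mk≤ (K.≤-reflexive (K.+-comm (ray 1⁺ b) (ray (mk⁺ q 0<q *⁺ 1⁺) b))))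
          (scale-mono (mk⁺ q 0<q) 0≤u)) (Sym.lhs≤rhs (Scalars.⊛≈*ₗ (mk⁺ q 0<q) u))
      }

-- Products of Riesz spaces with pointwise structure.

productRieszSpace : ∀ {c ℓ₁ ℓ₂ i m ℓm ℓ≤ : Level} (ℝ : RealNumbers c ℓ₁ ℓ₂) {I : Set i} →
  (I → RieszSpace ℝ m ℓm ℓ≤) → RieszSpace ℝ (i ⊔ m) (i ⊔ ℓm) (i ⊔ ℓ≤)
productRieszSpace ℝ {I} W = record
  { vectorSpace = record
    { Carrierᴹ = ∀ i → Carrierᴹ (W i)
    ; _≈ᴹ_ = λ u v → ∀ i → _≈ᴹ_ (W i) (u i) (v i)
    ; _+ᴹ_ = λ u v i → _+ᴹ_ (W i) (u i) (v i)
    ; _*ₗ_ = λ r u i → _*ₗ_ (W i) r (u i)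
    ; 0ᴹ   = λ i → 0ᴹ (W i)
    ; -ᴹ_  = λ u i → -ᴹ_ (W i) (u i)
    ; isLeftModule = record
      { isLeftSemimodule = record
        { +ᴹ-isCommutativeMonoid = record
          { isMonoid = record
            { isSemigroup = record
              { isMagma = record
                { isEquivalence = record
                  { refl  = λ i → ≈ᴹ-refl (W i)
                  ; sym   = λ e i → ≈ᴹ-sym (W i) (e i)
                  ; trans = λ e f i → ≈ᴹ-trans (W i) (e i) (f i)
                  }
                ; ∙-cong = λ e f i → +ᴹ-cong (W i) (e i) (f i)
                }
              ; assoc = λ u v w i → +ᴹ-assoc (W i) (u i) (v i) (w i)
              }
            ; identity = (λ u i → +ᴹ-identityˡ (W i) (u i)) , (λ u i → +ᴹ-identityʳ (W i) (u i))
            }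
          ; comm = λ u v i → +ᴹ-comm (W i) (u i) (v i)
          }
        ; isPreleftSemimodule = record
          { *ₗ-cong      = λ r≈s e i → *ₗ-cong (W i) r≈s (e i)
          ; *ₗ-zeroˡ     = λ u i → *ₗ-zeroˡ (W i) (u i)
          ; *ₗ-distribʳ  = λ u r s i → *ₗ-distribʳ (W i) (u i) r s
          ; *ₗ-identityˡ = λ u i → *ₗ-identityˡ (W i) (u i)
          ; *ₗ-assoc     = λ r s u i → *ₗ-assoc (W i) r s (u i)
          ; *ₗ-zeroʳ     = λ r i → *ₗ-zeroʳ (W i) r
          ; *ₗ-distribˡ  = λ r u v i → *ₗ-distribˡ (W i) r (u i) (v i)
          }
        }
      ; -ᴹ‿cong    = λ e i → -ᴹ‿cong (W i) (e i)
      ; -ᴹ‿inverse = (λ u i → -ᴹ‿inverseˡ (W i) (u i)) , (λ u i → -ᴹ‿inverseʳ (W i) (u i))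
      }
    }
  ; _≤_ = λ u v → ∀ i → _≤_ (W i) (u i) (v i)
  ; _∨_ = λ u v i → _∨_ (W i) (u i) (v i)
  ; _∧_ = λ u v i → _∧_ (W i) (u i) (v i)
  ; isLattice = record
    { isPartialOrder = record
      { isPreorder = record
        { isEquivalence = record
          { refl  = λ i → ≈ᴹ-refl (W i)
          ; sym   = λ e i → ≈ᴹ-sym (W i) (e i)
          ; trans = λ e f i → ≈ᴹ-trans (W i) (e i) (f i)
          }
        ; reflexive = λ e i → ≤-reflexive (W i) (e i)
        ; trans     = λ p q i → ≤-trans (W i) (p i) (q i)
        }
      ; antisym = λ p q i → ≤-antisym (W i) (p i) (q i)
      }
    ; supremum = λ u v →
        (λ i → x≤x∨y (W i) (u i) (v i)) , (λ i → y≤x∨y (W i) (u i) (v i)) ,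
        (λ _ p q i → ∨-least (W i) (p i) (q i))
    ; infimum = λ u v →
        (λ i → x∧y≤x (W i) (u i) (v i)) , (λ i → x∧y≤y (W i) (u i) (v i)) ,
        (λ _ p q i → ∧-greatest (W i) (p i) (q i))
    }
  ; +ᴹ-monoˡ = λ w p i → +ᴹ-monoˡ (W i) (w i) (p i)
  ; *ₗ-pos   = λ 0<q p i → *ₗ-pos (W i) 0<q (p i)
  }
  where open RieszSpace

-- The embedding into a power of the space of differences.

module Embedding {c ℓ₁ ℓ₂ a ℓ : Level} (ℝ : RealNumbers c ℓ₁ ℓ₂)
                 (𝕏 : ConvexSemilattice ℝ a ℓ) (cancel : Cancellative ℝ 𝕏) where
  private
    module ℝ = RealNumbers ℝ
    module X = ConvexSemilattice 𝕏
    module X≈ = IsEquivalence X.isEquivalence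
    module K = Cone ℝ 𝕏 cancel
    module D = Differences ℝ 𝕏 cancel
    module W (b : X.Carrier) = RieszSpace (D.Based.rieszSpace b)
    module WL (b : X.Carrier) = RieszLemmas ℝ (D.Based.rieszSpace b)
  open OpenUnitInterval ℝ
  open PositiveReals ℝ
  open X using (_⊕_; _+⟨_⟩_) renaming (_≈_ to _≈ˣ_)

  _⊖_ : X.Carrier → X.Carrier → D.Diff
  x ⊖ b = D.diff 1⁺ x b

  ⊖-congˡ : ∀ {x y} b → x ≈ˣ y → x ⊖ b D.≈ y ⊖ b
  ⊖-congˡ b x≈y = D.parts-≈ (K.mk≈ ℝ.refl x≈y) K.refl

  -- Over a common base point both crossed sums end in `K.ray 1⁺ b`, which cancels in the cone.
  ⊖-injective : ∀ {x y b} → x ⊖ b D.≈ y ⊖ b → x ≈ˣ y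
  ⊖-injective {x} {y} {b} (D.mk≤ x≤y Sym., D.mk≤ y≤x) =
    K._≈_.point≈ (K.+-cancelʳ (K.ray 1⁺ b) (K.≤-antisym x≤y y≤x))

  -- The weights p and 1 - p add up to 1, and p/(p + (1 - p)) is p. This ties the sum of the cone to
  -- the convex operations of X.
  convex-ray : ∀ x y p → K.ray 1⁺ (x +⟨ p ⟩ y) K.≈
    K.scale (fromUnit p) (K.ray 1⁺ x) K.+ K.scale (fromUnit (1-ᴵ p)) (K.ray 1⁺ y)
  convex-ray x y p = K.mk≈
    (ℝ.sym (ℝ.trans (ℝ.+-cong (ℝ.*-identityʳ _) (ℝ.*-identityʳ _)) (x+[y-x]≈y (value p) ℝ.1#)))
    (K.+⟨⟩-congʷ {p} {frac (p⁺ *⁺ 1⁺) (q⁺ *⁺ 1⁺)} (ℝ.trans (frac-unit p)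
      (frac-cong {p⁺} {p⁺ *⁺ 1⁺} {q⁺} {q⁺ *⁺ 1⁺}
        (ℝ.sym (ℝ.*-identityʳ _)) (ℝ.sym (ℝ.*-identityʳ _)))))
    where
    p⁺ q⁺ : ℝ⁺
    p⁺ = fromUnit p
    q⁺ = fromUnit (1-ᴵ p)

  ⊖-homo-+ : ∀ x y p b → (x +⟨ p ⟩ y) ⊖ b D.≈ W._+⟨_⟩ᴹ_ b (x ⊖ b) p (y ⊖ b)
  ⊖-homo-+ x y p b = D.≈-trans
    (D.parts-≈ (convex-ray x y p)
      -- By idempotence `b` is replaced by its combination with itself, so that the subtrahend
      -- splits in the same proportions as the minuend.
      (K.trans (K.mk≈ ℝ.refl (X≈.sym (X.+-idem b p))) (convex-ray b b p)))
    (W.+ᴹ-cong b (D.Based.Scalars.⊛≈*ₗ b (fromUnit p) (x ⊖ b))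
                 (D.Based.Scalars.⊛≈*ₗ b (fromUnit (1-ᴵ p)) (y ⊖ b)))

  -- Both sides are least upper bounds of the same pair: `x ⊖ b` and `y ⊖ b` already share weight
  -- and subtrahend, so the left side is their `join`.
  ⊖-homo-⊕ : ∀ x y b → (x ⊕ y) ⊖ b D.≈ (x ⊖ b) D.∨ (y ⊖ b)
  ⊖-homo-⊕ x y b =
    D.join-least 1⁺ x y b (D.u≤u∨v (x ⊖ b) (y ⊖ b)) (D.v≤u∨v (x ⊖ b) (y ⊖ b))
    Sym., D.∨-least (x ⊖ b) (y ⊖ b) (D.x≤join 1⁺ x y b) (D.y≤join 1⁺ x y b)

  -- If X is empty, this is the zero space and `Y` below is its empty subset.
  V : RieszSpace ℝ (c ⊔ ℓ₁ ⊔ ℓ₂ ⊔ a ⊔ ℓ) (c ⊔ ℓ₁ ⊔ ℓ₂ ⊔ a ⊔ ℓ) (c ⊔ ℓ₁ ⊔ ℓ₂ ⊔ a ⊔ ℓ)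
  V = productRieszSpace ℝ D.Based.rieszSpace

  -- The image of X, closed under the equality of `V`. A membership proof carries a preimage, from
  -- which surjectivity is read off.
  Y : ConvexSupClosedSubset ℝ V (c ⊔ ℓ₁ ⊔ ℓ₂ ⊔ a ⊔ ℓ)
  Y = record
    { Member   = λ v → Σ[ x ∈ X.Carrier ] ∀ b → x ⊖ b D.≈ v b
    ; respects = λ u≈v (x , e) → x , λ b → D.≈-trans (e b) (u≈v b)
    ; convex   = λ p (x , e) (y , f) → x +⟨ p ⟩ y , λ b →
        D.≈-trans (⊖-homo-+ x y p b)
          (IsConvexAlgebra.+-cong (WL.isConvexAlgebra b) {p = p} {p′ = p} (e b) ℝ.refl (f b))
    ; ∨-closed = λ (x , e) (y , f) → x ⊕ y , λ b →
        D.≈-trans (⊖-homo-⊕ x y b) (WL.∨-cong b (e b) (f b))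
    }

  isomorphism : Isomorphism ℝ 𝕏 (induced ℝ V Y)
  isomorphism = record
    { to        = λ x → (x ⊖_) , x , λ b → ⊖-congˡ b X≈.refl
    ; cong      = λ x≈y b → ⊖-congˡ b x≈y
    ; bijective = (λ {x} e → ⊖-injective (e x))
                , (λ (v , x , e) → x , λ z≈x b → D.≈-trans (⊖-congˡ b z≈x) (e b))
    ; +-homo    = ⊖-homo-+
    ; ⊕-homo    = ⊖-homo-⊕
    }

theorem6 : ∀ {c ℓ₁ ℓ₂ a ℓ : Level}
    (ℝ : RealNumbers c ℓ₁ ℓ₂) (𝕏 : ConvexSemilattice ℝ a ℓ) →
    Cancellative ℝ 𝕏 →
    Σ[ V ∈ RieszSpace ℝ (c ⊔ ℓ₁ ⊔ ℓ₂ ⊔ a ⊔ ℓ) (c ⊔ ℓ₁ ⊔ ℓ₂ ⊔ a ⊔ ℓ) (c ⊔ ℓ₁ ⊔ ℓ₂ ⊔ a ⊔ ℓ) ]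
    Σ[ Y ∈ ConvexSupClosedSubset ℝ V (c ⊔ ℓ₁ ⊔ ℓ₂ ⊔ a ⊔ ℓ) ]
    Isomorphism ℝ 𝕏 (induced ℝ V Y)
theorem6 ℝ 𝕏 cancel = V , Y , isomorphism
  where open Embedding ℝ 𝕏 cancel
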